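{- The worst case time complexity of the algorithm isTreeConvex (described in the context), which identifies the tree convexity of a collection of sets $S=\{S_1,\dots,S_m\}$, is linear in the problem size $\sum_{i=1}^m |S_i|$.
   Context: **Tree convexity.** Let $S=\{S_1,\dots,S_m\}$ be a finite collection of finite nonempty sets and $U(S)=S_1\cup\dots\cup S_m$. The collection $S$ is tree convex with respect to a forest $\mathcal T$ whose vertex set is exactly $U(S)$ if every $S_i$ is a subtree of $\mathcal T$, i.e. the vertex set of a connected subgraph of a tree of $\mathcal T$. $S$ is tree convex if such a forest exists (equivalently, if such a tree exists). **Dual hypergraph.** The dual hypergraph $D$ of $S$ has vertex set $\{S_1,\dots,S_m\}$ and one edge $R_a=\{S_j : a\in S_j\}$ for each $a\in U(S)$; the edges are labelled by $a$, and the edge $R_a$ is identified with the element $a$. Write $\mathcal E$ for the edges of $D$ and $U(\mathcal E)$ for the union of these edges. **Acyclic hypergraph.** A hypergraph is acyclic iff it has a join tree: a tree whose nodes are the edges of the hypergraph, such that two adjacent edges intersect and, for any two edges $E,F$ and any $v\in E\cap F$, all edges on the tree path from $E$ to $F$ contain $v$. **Algorithm isTreeConvex(S).** Construct the dual hypergraph $D$ of $S$. Run isAcyclic on $D$, which tests whether $D$ is acyclic. If it returns true, it also provides data $R$ and $\gamma$; then run genForest with $D,R,\gamma$ to build $\mathcal T$ and return (true, $\mathcal T$). Otherwise return false. **isAcyclic (restricted maximum cardinality search on hypergraphs, followed by a test).** Let $N=|U(\mathcal E)|$. 1. Set $set(i)=\emptyset$ for $i=0,\dots,N-1$. For each $E\in\mathcal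 E$ set $size(E)=0$, $\gamma(E)$ undefined, and add $E$ to $set(0)$. Set $i=N+1$, $j=0$, $k=0$. 2. While $j\ge 0$: - delete any $E$ from $set(j)$; increase $k$ by 1; set $\beta(E)=k$, $R(k)=E$, $size(E)=-1$; - for each $v\in E$ with $\alpha(v)$ not assigned: decrease $i$ by 1; set $\alpha(v)=i$, $\beta(v)=k$; and for each $F\in\mathcal E$ with $v\in F$ and $size(F)\ge 0$: set $\gamma(F)=k$, delete $F$ from $set(size(F))$, increase $size(F)$ by 1; if $size(F)<|F|$, add $F$ to $set(size(F))$ and, if $j<size(F)$, set $j=size(F)$; otherwise set $size(F)=-1$; - while $j\ge0$ and $set(j)=\emptyset$, decrease $j$ by 1. 3. Set $index(v)=0$ for all $v\in U(\mathcal E)$. For each $i=1,\dots,k$: set $index(v)=i$ for all $v\in R(i)$; then for each $E\in\mathcal E$ with $\gamma(E)=i$ and each $v\in E$, if $\beta(v)<i$ and $index(v)<i$, return false. If the loop finishes, return true. **genForest.** $\mathcal T$ is the graph with vertex set $\mathcal E$ and edge set $\{\{F,R(\gamma(F))\} : F\in\mathcal E,\ \gamma(F)\text{ defined}\}$; through the identification of $R_a$ with $a$, it is the forest with respect to which $S$ is tree convex. -}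

module Defs where

open import Data.Bool.Base using (Bool; true; false; not; _∧_; if_then_else_)
open import Data.Fin.Base using (Fin; toℕ)
open import Data.Integer.Base using (ℤ; +_; -1ℤ; 0ℤ; 1ℤ; _%ℕ_; _≤ᵇ_)
  renaming (_+_ to _+ℤ_; _-_ to _-ℤ_)
import Data.Integer.Properties as ℤ
open import Data.List.Base using (List; []; length; lookup; tabulate)
open import Data.List.Membership.Propositional using (_∈_)
open import Data.List.Relation.Unary.Unique.Propositional using (Unique)
open import Data.Nat.Base using (ℕ; suc; _+_; _<_; _≡ᵇ_)
open import Data.Nat.ListAction using (sum)
open import Data.Product.Base using (∃-syntax; _,_)
open import Relation.Binary.PropositionalEquality.Core using (_≡_; _≢_; refl)
open import Relation.Nullary.Decidable.Core using (isYes)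

------------------------------------------------------------------------
-- Problem instances

-- A collection S₁,…,Sₘ whose universe U(S) is enumerated as Fin numElements.
-- Each Sᵢ is an array of pairwise distinct elements, in arbitrary order.
record Collection : Set where
  field
    numSets     : ℕ
    numElements : ℕ
    member      : Fin numSets → List (Fin numElements)
    numSets>0   : 0 < numSets
    distinct    : ∀ i → Unique (member i)
    nonempty    : ∀ i → member i ≢ []
    covers      : ∀ a → ∃[ i ] a ∈ member i

problemSize : Collection → ℕ
problemSize S = sum (tabulate (λ i → length (member i)))
  where open Collection S

------------------------------------------------------------------------
-- A unit-cost random access machine, presented as a small imperative
-- language over integer registers and integer tables.

data Var : Set where
  #m #n #N i j k t x p q a u v E F ok slot last moved : Var

data Table : Set where
  sets setLen edges edgeLen bucket card pos
    size γ βᴱ βⱽ α R index child childLen forest oracle : Table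

codeᵛ : Var → ℕ
codeᵛ #m = 0
codeᵛ #n = 1
codeᵛ #N = 2
codeᵛ i = 3
codeᵛ j = 4
codeᵛ k = 5
codeᵛ t = 6
codeᵛ x = 7
codeᵛ p = 8
codeᵛ q = 9
codeᵛ a = 10
codeᵛ u = 11
codeᵛ v = 12
codeᵛ E = 13
codeᵛ F = 14
codeᵛ ok = 15
codeᵛ slot = 16
codeᵛ last = 17
codeᵛ moved = 18

codeᵗ : Table → ℕ
codeᵗ sets = 0
codeᵗ setLen = 1
codeᵗ edges = 2
codeᵗ edgeLen = 3
codeᵗ bucket = 4
codeᵗ card = 5
codeᵗ pos = 6
codeᵗ size = 7
codeᵗ γ = 8
codeᵗ βᴱ = 9
codeᵗ βⱽ = 10
codeᵗ α = 11
codeᵗ R = 12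
codeᵗ index = 13
codeᵗ child = 14
codeᵗ childLen = 15
codeᵗ forest = 16
codeᵗ oracle = 17

-- Every table is two-dimensional; one-dimensional tables use column 0.
-- Cell (r , c) stands for address r * W + c of an ordinary array, for W > m, n;
-- all numbers and addresses formed by the program are polynomial in m and n.
record Store : Set where
  constructor store
  field
    var : Var → ℤ
    tab : Table → ℤ → ℤ → ℤ
open Store public

setVar : Var → ℤ → Store → Store
setVar y z σ = store (λ y′ → if codeᵛ y ≡ᵇ codeᵛ y′ then z else var σ y′) (tab σ)

setCell : Table → ℤ → ℤ → ℤ → Store → Store
setCell T r c z σ = store (var σ) λ T′ r′ c′ →
  if (codeᵗ T ≡ᵇ codeᵗ T′) ∧ isYes (r ℤ.≟ r′) ∧ isYes (c ℤ.≟ c′)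
  then z else tab σ T′ r′ c′

infix  9 _⟦_∣_⟧ _⟦_⟧
infixl 7 _mod_
infixl 6 _⊕_ _⊖_
infix  4 _≤̇_ _<̇_ _=̇_
infixr 3 _and_

data Exp : Set where
  lit     : ℤ → Exp
  !_      : Var → Exp
  _⟦_∣_⟧  : Table → Exp → Exp → Exp
  _⊕_ _⊖_ _mod_ : Exp → Exp → Exp

data Test : Set where
  _≤̇_ _<̇_ _=̇_ : Exp → Exp → Test
  _and_ : Test → Test → Test

_⟦_⟧ : Table → Exp → Exp
T ⟦ e ⟧ = T ⟦ e ∣ lit 0ℤ ⟧

-- Only applied to positive divisors by the program below.
modℤ : ℤ → ℤ → ℤ
modℤ z (+ suc d) = + (z %ℕ suc d)
modℤ z _         = 0ℤ

evalᵉ : Exp → Store → ℤ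
evalᵉ (lit z)       σ = z
evalᵉ (! y)         σ = var σ y
evalᵉ (T ⟦ r ∣ c ⟧) σ = tab σ T (evalᵉ r σ) (evalᵉ c σ)
evalᵉ (d ⊕ e)       σ = evalᵉ d σ +ℤ evalᵉ e σ
evalᵉ (d ⊖ e)       σ = evalᵉ d σ -ℤ evalᵉ e σ
evalᵉ (d mod e)     σ = modℤ (evalᵉ d σ) (evalᵉ e σ)

evalᵇ : Test → Store → Bool
evalᵇ (d ≤̇ e)   σ = evalᵉ d σ ≤ᵇ evalᵉ e σ
evalᵇ (d <̇ e)   σ = not (evalᵉ e σ ≤ᵇ evalᵉ d σ)
evalᵇ (d =̇ e)   σ = isYes (evalᵉ d σ ℤ.≟ evalᵉ e σ)
evalᵇ (b and c) σ = evalᵇ b σ ∧ evalᵇ c σ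

-- One time unit per literal, register access, table access, arithmetic
-- operation, comparison and connective.
costᵉ : Exp → ℕ
costᵉ (lit z)       = 1
costᵉ (! y)         = 1
costᵉ (T ⟦ r ∣ c ⟧) = 1 + costᵉ r + costᵉ c
costᵉ (d ⊕ e)       = 1 + costᵉ d + costᵉ e
costᵉ (d ⊖ e)       = 1 + costᵉ d + costᵉ e
costᵉ (d mod e)     = 1 + costᵉ d + costᵉ e

costᵇ : Test → ℕ
costᵇ (d ≤̇ e)   = 1 + costᵉ d + costᵉ e
costᵇ (d <̇ e)   = 1 + costᵉ d + costᵉ e
costᵇ (d =̇ e)   = 1 + costᵉ d + costᵉ e
costᵇ (b and c) = 1 + costᵇ b + costᵇ c

infix  2 _≔_ _⟦_∣_⟧←_ _⟦_⟧←_ _≔call_ when_then_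
infixr 1 _︔_

data Com : Set where
  skip         : Com
  _≔_          : Var → Exp → Com
  _⟦_∣_⟧←_     : Table → Exp → Exp → Exp → Com
  _︔_          : Com → Com → Com
  cond         : Test → Com → Com → Com
  while        : Test → Com → Com
  return       : Exp → Com
  _≔call_      : Var → Com → Com    -- `return` leaves only the called block

_⟦_⟧←_ : Table → Exp → Exp → Com
T ⟦ e ⟧← d = T ⟦ e ∣ lit 0ℤ ⟧← d

when_then_ : Test → Com → Com
when b then c = cond b c skip

for : Var → Exp → Exp → Com → Com
for y lo hi c = (y ≔ lo) ︔ while (! y <̇ hi) (c ︔ (y ≔ ! y ⊕ lit 1ℤ))

syntax for y lo hi c = for y from lo below hi do[ c ]

data Outcome : Set where
  finished : Outcome
  returned : ℤ → Outcome

assignResult : Var → Outcome → Store → Store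
assignResult y finished     σ = σ
assignResult y (returned z) σ = setVar y z σ

-- ⟨ c , σ ⟩⇓⟨ o , σ′ ⟩in n : started in σ, command c halts after exactly
-- n time units in σ′ with outcome o.
infix 0 ⟨_,_⟩⇓⟨_,_⟩in_

data ⟨_,_⟩⇓⟨_,_⟩in_ : Com → Store → Outcome → Store → ℕ → Set where

  ⇓-skip : ∀ {σ} → ⟨ skip , σ ⟩⇓⟨ finished , σ ⟩in 0

  ⇓-assign : ∀ {y e σ} →
    ⟨ y ≔ e , σ ⟩⇓⟨ finished , setVar y (evalᵉ e σ) σ ⟩in suc (costᵉ e)

  ⇓-write : ∀ {T r c e σ} →
    ⟨ T ⟦ r ∣ c ⟧← e , σ ⟩⇓⟨ finished , setCell T (evalᵉ r σ) (evalᵉ c σ) (evalᵉ e σ) σ ⟩in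
      suc (costᵉ r + costᵉ c + costᵉ e)

  ⇓-seq : ∀ {c d σ σ′ σ″ o n n′} →
    ⟨ c , σ ⟩⇓⟨ finished , σ′ ⟩in n →
    ⟨ d , σ′ ⟩⇓⟨ o , σ″ ⟩in n′ →
    ⟨ c ︔ d , σ ⟩⇓⟨ o , σ″ ⟩in n + n′

  ⇓-seq-return : ∀ {c d σ σ′ z n} →
    ⟨ c , σ ⟩⇓⟨ returned z , σ′ ⟩in n →
    ⟨ c ︔ d , σ ⟩⇓⟨ returned z , σ′ ⟩in n

  ⇓-cond : ∀ {b c d σ σ′ o n} →
    ⟨ (if evalᵇ b σ then c else d) , σ ⟩⇓⟨ o , σ′ ⟩in n →
    ⟨ cond b c d , σ ⟩⇓⟨ o , σ′ ⟩in suc (costᵇ b + n)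

  ⇓-while : ∀ {b c σ σ′ o n} →
    ⟨ (if evalᵇ b σ then (c ︔ while b c) else skip) , σ ⟩⇓⟨ o , σ′ ⟩in n →
    ⟨ while b c , σ ⟩⇓⟨ o , σ′ ⟩in suc (costᵇ b + n)

  ⇓-return : ∀ {e σ} →
    ⟨ return e , σ ⟩⇓⟨ returned (evalᵉ e σ) , σ ⟩in suc (costᵉ e)

  ⇓-call : ∀ {y c σ σ′ o n} →
    ⟨ c , σ ⟩⇓⟨ o , σ′ ⟩in n →
    ⟨ y ≔call c , σ ⟩⇓⟨ finished , assignResult y o σ′ ⟩in suc n

-- Executions are unique, so one may speak of the running time from σ.
⇓-deterministic : ∀ {c σ o₁ o₂ σ₁ σ₂ n₁ n₂} →
  ⟨ c , σ ⟩⇓⟨ o₁ , σ₁ ⟩in n₁ → ⟨ c , σ ⟩⇓⟨ o₂ , σ₂ ⟩in n₂ →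
  (o₁ , σ₁ , n₁) ≡ (o₂ , σ₂ , n₂)
⇓-deterministic ⇓-skip   ⇓-skip   = refl
⇓-deterministic ⇓-assign ⇓-assign = refl
⇓-deterministic ⇓-write  ⇓-write  = refl
⇓-deterministic ⇓-return ⇓-return = refl
⇓-deterministic (⇓-seq d e) (⇓-seq d′ e′) with refl ← ⇓-deterministic d d′
                                          with refl ← ⇓-deterministic e e′ = refl
⇓-deterministic (⇓-seq d e)      (⇓-seq-return d′) with () ← ⇓-deterministic d d′
⇓-deterministic (⇓-seq-return d) (⇓-seq d′ e′)     with () ← ⇓-deterministic d d′
⇓-deterministic (⇓-seq-return d) (⇓-seq-return d′) with refl ← ⇓-deterministic d d′ = refl
⇓-deterministic (⇓-cond d)  (⇓-cond d′)  with refl ← ⇓-deterministic d d′ = refl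
⇓-deterministic (⇓-while d) (⇓-while d′) with refl ← ⇓-deterministic d d′ = refl
⇓-deterministic (⇓-call d)  (⇓-call d′)  with refl ← ⇓-deterministic d d′ = refl

------------------------------------------------------------------------
-- The algorithm
--
-- The vertices of the dual hypergraph (the sets Sᵢ) are the integers
-- 0,…,m-1 and its edges (the elements of U(S)) are 0,…,n-1.  The edges
-- containing vertex v are therefore exactly the entries of row v of `sets`.

-- Contents of memory at the start.  All registers and cells not mentioned
-- are arbitrary; in particular the program never relies on zeroed memory.
record _Encodes_ (σ : Store) (S : Collection) : Set where
  open Collection S
  field
    var-m      : var σ #m ≡ + numSets
    var-n      : var σ #n ≡ + numElements
    tab-setLen : ∀ i → tab σ setLen (+ toℕ i) 0ℤ ≡ + length (member i)
    tab-sets   : ∀ i r → tab σ sets (+ toℕ i) (+ toℕ r) ≡ + toℕ (lookup (member i) r)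

constructDual : Com
constructDual =
  for a from lit 0ℤ below ! #n do[ edgeLen ⟦ ! a ⟧← lit 0ℤ ] ︔
  for v from lit 0ℤ below ! #m do[
    for q from lit 0ℤ below setLen ⟦ ! v ⟧ do[
      (a ≔ sets ⟦ ! v ∣ ! q ⟧) ︔
      (edges ⟦ ! a ∣ edgeLen ⟦ ! a ⟧ ⟧← ! v) ︔
      (edgeLen ⟦ ! a ⟧← edgeLen ⟦ ! a ⟧ ⊕ lit 1ℤ) ] ]

-- set(s) is the unordered array bucket⟦s∣0⟧,…,bucket⟦s∣card⟦s⟧-1⟧, with
-- pos⟦G⟧ the position of G in the one array that contains it.  A member is
-- deleted by moving the last entry into its place.
infix 2 add_to_ delete_from_ choose_from_

add_to_ : Var → Exp → Com
add G to s =
  (pos ⟦ ! G ⟧← card ⟦ s ⟧) ︔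
  (bucket ⟦ s ∣ card ⟦ s ⟧ ⟧← ! G) ︔
  (card ⟦ s ⟧← card ⟦ s ⟧ ⊕ lit 1ℤ)

delete_from_ : Var → Exp → Com
delete G from s =
  (slot ≔ pos ⟦ ! G ⟧) ︔
  (last ≔ card ⟦ s ⟧ ⊖ lit 1ℤ) ︔
  (moved ≔ bucket ⟦ s ∣ ! last ⟧) ︔
  (bucket ⟦ s ∣ ! slot ⟧← ! moved) ︔
  (pos ⟦ ! moved ⟧← ! slot) ︔
  (card ⟦ s ⟧← ! last)

-- "Any" element of set(s).  The k-th choice is dictated by oracle⟦k⟧, which
-- is arbitrary initial memory, read once and never written: quantifying over
-- initial stores quantifies over all ways of making the choices.
choose_from_ : Var → Exp → Com
choose G from s = G ≔ bucket ⟦ s ∣ oracle ⟦ ! k ⟧ mod card ⟦ s ⟧ ⟧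

-- α = 0 and γ = 0 encode "undefined"; values assigned to them are positive.
initialise : Com
initialise =
  (#N ≔ ! #m) ︔               -- every Sᵢ is nonempty, so U(𝓔) = {S₁,…,Sₘ}
  for x from lit 0ℤ below ! #N do[ card ⟦ ! x ⟧← lit 0ℤ ] ︔
  for v from lit 0ℤ below ! #N do[ α ⟦ ! v ⟧← lit 0ℤ ] ︔
  for E from lit 0ℤ below ! #n do[
    (size ⟦ ! E ⟧← lit 0ℤ) ︔
    (γ ⟦ ! E ⟧← lit 0ℤ) ︔
    add E to lit 0ℤ ] ︔
  (i ≔ ! #N ⊕ lit 1ℤ) ︔
  (j ≔ lit 0ℤ) ︔
  (k ≔ lit 0ℤ)

search : Com
search =
  while (lit 0ℤ ≤̇ ! j) (
    choose E from ! j ︔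
    delete E from ! j ︔
    (k ≔ ! k ⊕ lit 1ℤ) ︔
    (βᴱ ⟦ ! E ⟧← ! k) ︔
    (R ⟦ ! k ⟧← ! E) ︔
    (size ⟦ ! E ⟧← lit -1ℤ) ︔
    for p from lit 0ℤ below edgeLen ⟦ ! E ⟧ do[
      (v ≔ edges ⟦ ! E ∣ ! p ⟧) ︔
      (when α ⟦ ! v ⟧ =̇ lit 0ℤ then (
        (i ≔ ! i ⊖ lit 1ℤ) ︔
        (α ⟦ ! v ⟧← ! i) ︔
        (βⱽ ⟦ ! v ⟧← ! k) ︔
        for q from lit 0ℤ below setLen ⟦ ! v ⟧ do[
          (F ≔ sets ⟦ ! v ∣ ! q ⟧) ︔
          (when lit 0ℤ ≤̇ size ⟦ ! F ⟧ then (
            (γ ⟦ ! F ⟧← ! k) ︔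
            delete F from size ⟦ ! F ⟧ ︔
            (size ⟦ ! F ⟧← size ⟦ ! F ⟧ ⊕ lit 1ℤ) ︔
            cond (size ⟦ ! F ⟧ <̇ edgeLen ⟦ ! F ⟧)
              (add F to size ⟦ ! F ⟧ ︔
               (when ! j <̇ size ⟦ ! F ⟧ then (j ≔ size ⟦ ! F ⟧)))
              (size ⟦ ! F ⟧← lit -1ℤ))) ])) ] ︔
    while (lit 0ℤ ≤̇ ! j and card ⟦ ! j ⟧ =̇ lit 0ℤ) (j ≔ ! j ⊖ lit 1ℤ))

-- Lists the edges with γ(E) = g in row g of `child`, so that the test can
-- enumerate them without scanning all of 𝓔 for every g.
groupByγ : Com
groupByγ =
  for x from lit 1ℤ below ! k ⊕ lit 1ℤ do[ childLen ⟦ ! x ⟧← lit 0ℤ ] ︔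
  for E from lit 0ℤ below ! #n do[
    (when lit 0ℤ <̇ γ ⟦ ! E ⟧ then (
      (x ≔ γ ⟦ ! E ⟧) ︔
      (child ⟦ ! x ∣ childLen ⟦ ! x ⟧ ⟧← ! E) ︔
      (childLen ⟦ ! x ⟧← childLen ⟦ ! x ⟧ ⊕ lit 1ℤ))) ]

test : Com
test =
  for v from lit 0ℤ below ! #N do[ index ⟦ ! v ⟧← lit 0ℤ ] ︔
  groupByγ ︔
  for i from lit 1ℤ below ! k ⊕ lit 1ℤ do[
    (F ≔ R ⟦ ! i ⟧) ︔
    for p from lit 0ℤ below edgeLen ⟦ ! F ⟧ do[
      index ⟦ edges ⟦ ! F ∣ ! p ⟧ ⟧← ! i ] ︔
    for p from lit 0ℤ below childLen ⟦ ! i ⟧ do[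
      (E ≔ child ⟦ ! i ∣ ! p ⟧) ︔
      for q from lit 0ℤ below edgeLen ⟦ ! E ⟧ do[
        (v ≔ edges ⟦ ! E ∣ ! q ⟧) ︔
        (when βⱽ ⟦ ! v ⟧ <̇ ! i and index ⟦ ! v ⟧ <̇ ! i then return (lit 0ℤ)) ] ] ] ︔
  return (lit 1ℤ)

isAcyclic : Com
isAcyclic = initialise ︔ search ︔ test

-- The forest has vertices 0,…,n-1 and the edges {forest⟦s∣0⟧, forest⟦s∣1⟧}
-- for s < t.
genForest : Com
genForest =
  (t ≔ lit 0ℤ) ︔
  for F from lit 0ℤ below ! #n do[
    (when lit 0ℤ <̇ γ ⟦ ! F ⟧ then (
      (forest ⟦ ! t ∣ lit 0ℤ ⟧← ! F) ︔
      (forest ⟦ ! t ∣ lit 1ℤ ⟧← R ⟦ γ ⟦ ! F ⟧ ⟧) ︔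
      (t ≔ ! t ⊕ lit 1ℤ))) ]

-- Returns 1 for true, with the forest left in memory, and 0 for false.
isTreeConvex : Com
isTreeConvex =
  constructDual ︔
  (ok ≔call isAcyclic) ︔
  cond (! ok =̇ lit 1ℤ)
    (genForest ︔ return (lit 1ℤ))
    (return (lit 0ℤ))

{-# OPTIONS --safe #-}

-- The running time is bounded by amortisation, in credits attached to the data.  Initially every
-- edge holds credits proportional to 1 + |E|, every vertex credits proportional to 1 + |S_v|, and
-- j holds two credits for each value it can still be lowered through.  Removing an edge from the
-- queue, which happens once per edge because its size becomes -1, releases the credits that pay for
-- enumerating its vertices; numbering a vertex, which happens once because α becomes positive,
-- releases those that pay for updating its edges.  Sizes in the queue never exceed j, so one size
-- update raises j by at most one.  In the test the scanned rows are the removed edges R(1),…,R(k)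
-- and, grouped by γ, each edge at most once.  All these credits add up to O(m + n + Σ|E|), where
-- Σ|E| = Σ|Sᵢ|, m ≤ Σ|Sᵢ| as the sets are nonempty and n ≤ Σ|Sᵢ| as they cover the universe.

module Submission where

open import Defs hiding (i; j; k; t; x; p; q; a; u; v; E; F; ok; last; moved; slot)
open import Data.Bool.Base using (Bool; true; false; not; _∧_; _∨_; if_then_else_; T)
open import Data.Bool.Properties using (T-≡; ∧-conicalˡ; ∧-conicalʳ)
open import Data.Empty using (⊥)
open import Data.Fin.Base as Fin using (Fin; toℕ; fromℕ<)
open import Data.Fin.Properties using (toℕ<n; toℕ-fromℕ<; toℕ-injective; injective⇒≤)
open import Data.Integer.Base as ℤ using (ℤ; +_; -[1+_]; -1ℤ; 0ℤ; 1ℤ)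
  renaming (_+_ to _+ℤ_; _-_ to _-ℤ_)
open import Data.Integer.DivMod using (n%ℕd<d)
import Data.Integer.Properties as ℤ
open import Data.List.Base using (List; []; _∷_; length; lookup; tabulate; concat; applyUpTo)
open import Data.List.Membership.Propositional using (_∈_)
open import Data.List.Membership.Propositional.Properties using (∈-concat⁺′; ∈-tabulate⁺; ∈-lookup)
open import Data.List.Membership.Setoid.Properties using (index-injective)
open import Data.List.Properties using (length-++)
import Data.List.Relation.Unary.All as All
open import Data.List.Relation.Unary.AllPairs using (_∷_)
import Data.List.Relation.Unary.Any as Any
open import Data.List.Relation.Unary.Unique.Propositional using (Unique)
open import Data.Nat.Base using (ℕ; zero; suc; _+_; _*_; _≤_; _<_; z≤n; s≤s; _≤ᵇ_; _≡ᵇ_)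
open import Data.Nat.ListAction using (sum)
open import Data.Nat.Properties
open import Data.Nat.Tactic.RingSolver using (solve-∀)
open import Data.Product.Base using (∃-syntax; _×_; _,_; proj₁; proj₂)
open import Data.Unit.Base using (⊤; tt)
open import Function.Base using (_∘_; case_of_)
open import Function.Bundles using (module Equivalence)
open import Relation.Binary.PropositionalEquality hiding ([_])
open import Relation.Nullary using (Dec; yes; no; contradiction)
open import Relation.Nullary.Decidable.Core using (isYes)

-- Frame properties

-- Time cannot be separated from correctness here: memory starts out arbitrary and every deletion
-- follows positions stored by earlier steps, so one wrong position would void all later accounting.
-- The invariants therefore carry as much correctness as the credits rely on: `bucket` and `pos`
-- invert each other, no queued size exceeds j, and i is one more than the number of unnumbered
-- vertices. Values such as `βⱽ` and `index` only decide which branch is taken, and either branch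
-- can be afforded. Termination comes from the same accounting. An execution is constructed together
-- with its bound, and the fuel of a general loop is the credit at hand. The weight 16 in the
-- potential is what one entry of a set costs when its vertex is numbered; the scan of a chosen edge
-- costs less per vertex and uses the same factor.

assigns : Com → Var → Bool
assigns skip              y = false
assigns (y′ ≔ _)          y = codeᵛ y′ ≡ᵇ codeᵛ y
assigns (_ ⟦ _ ∣ _ ⟧← _)  y = false
assigns (c ︔ d)           y = assigns c y ∨ assigns d y
assigns (cond _ c d)      y = assigns c y ∨ assigns d y
assigns (while _ c)       y = assigns c y
assigns (return _)        y = false
assigns (y′ ≔call c)      y = (codeᵛ y′ ≡ᵇ codeᵛ y) ∨ assigns c y

writes : Com → Table → Bool
writes skip              V = false
writes (_ ≔ _)           V = false
writes (U ⟦ _ ∣ _ ⟧← _)  V = codeᵗ U ≡ᵇ codeᵗ V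
writes (c ︔ d)           V = writes c V ∨ writes d V
writes (cond _ c d)      V = writes c V ∨ writes d V
writes (while _ c)       V = writes c V
writes (return _)        V = false
writes (_ ≔call c)       V = writes c V

-- A conservative check: a write anywhere in a table counts as touching every cell of it. For
-- concrete programs it evaluates, so each side condition on a loop bound is proved by `refl`.
touches : Com → Exp → Bool
touches c (lit _)         = false
touches c (! y)           = assigns c y
touches c (V ⟦ r ∣ s ⟧)   = writes c V ∨ (touches c r ∨ touches c s)
touches c (d ⊕ e)         = touches c d ∨ touches c e
touches c (d ⊖ e)         = touches c d ∨ touches c e
touches c (d mod e)       = touches c d ∨ touches c e

∨-false : ∀ a {b} → a ∨ b ≡ false → a ≡ false × b ≡ false
∨-false false eq = refl , eq

assign-other : ∀ y′ y {z} σ → (codeᵛ y′ ≡ᵇ codeᵛ y) ≡ false → var (setVar y′ z σ) y ≡ var σ y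
assign-other y′ y σ eq rewrite eq = refl

write-other : ∀ U V r c {z} σ → (codeᵗ U ≡ᵇ codeᵗ V) ≡ false →
  ∀ r′ c′ → tab (setCell U r c z σ) V r′ c′ ≡ tab σ V r′ c′
write-other U V r c σ eq r′ c′ rewrite eq = refl

assigns-sound : ∀ {c σ o σ′ n} y → ⟨ c , σ ⟩⇓⟨ o , σ′ ⟩in n →
  assigns c y ≡ false → var σ′ y ≡ var σ y
assigns-sound y ⇓-skip a = refl
assigns-sound y (⇓-assign {y′} {σ = σ}) a = assign-other y′ y σ a
assigns-sound y ⇓-write a = refl
assigns-sound y (⇓-seq {c} e e′) a = let l , r = ∨-false (assigns c y) a in
  trans (assigns-sound y e′ r) (assigns-sound y e l)
assigns-sound y (⇓-seq-return {c} e) a = assigns-sound y e (proj₁ (∨-false (assigns c y) a))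
assigns-sound y (⇓-cond {b} {c} {σ = σ} e) a with evalᵇ b σ | e
... | true  | e = assigns-sound y e (proj₁ (∨-false (assigns c y) a))
... | false | e = assigns-sound y e (proj₂ (∨-false (assigns c y) a))
assigns-sound y (⇓-while {b} {c} {σ} e) a with evalᵇ b σ | e
... | true  | e = assigns-sound y e (cong₂ _∨_ a a)
... | false | e = assigns-sound y e refl
assigns-sound y ⇓-return a = refl
assigns-sound y (⇓-call {y′} {o = finished} e) a =
  assigns-sound y e (proj₂ (∨-false (codeᵛ y′ ≡ᵇ codeᵛ y) a))
assigns-sound y (⇓-call {y′} {σ′ = σ′} {o = returned _} e) a = let l , r = ∨-false (codeᵛ y′ ≡ᵇ codeᵛ y) a in
  trans (assign-other y′ y σ′ l) (assigns-sound y e r)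

writes-sound : ∀ {c σ o σ′ n} V → ⟨ c , σ ⟩⇓⟨ o , σ′ ⟩in n →
  writes c V ≡ false → ∀ r s → tab σ′ V r s ≡ tab σ V r s
writes-sound V ⇓-skip w r s = refl
writes-sound V ⇓-assign w r s = refl
writes-sound V (⇓-write {U} {r′} {s′} {σ = σ}) w r s =
  write-other U V (evalᵉ r′ σ) (evalᵉ s′ σ) σ w r s
writes-sound V (⇓-seq {c} e e′) w r s = let l , m = ∨-false (writes c V) w in
  trans (writes-sound V e′ m r s) (writes-sound V e l r s)
writes-sound V (⇓-seq-return {c} e) w = writes-sound V e (proj₁ (∨-false (writes c V) w))
writes-sound V (⇓-cond {b} {c} {σ = σ} e) w with evalᵇ b σ | e
... | true  | e = writes-sound V e (proj₁ (∨-false (writes c V) w))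
... | false | e = writes-sound V e (proj₂ (∨-false (writes c V) w))
writes-sound V (⇓-while {b} {c} {σ} e) w with evalᵇ b σ | e
... | true  | e = writes-sound V e (cong₂ _∨_ w w)
... | false | e = writes-sound V e refl
writes-sound V ⇓-return w r s = refl
writes-sound V (⇓-call {o = finished} e) w = writes-sound V e w
writes-sound V (⇓-call {o = returned _} e) w = writes-sound V e w

touches-sound : ∀ {c σ o σ′ n} e → ⟨ c , σ ⟩⇓⟨ o , σ′ ⟩in n →
  touches c e ≡ false → evalᵉ e σ′ ≡ evalᵉ e σ
touches-sound (lit z) x t = refl
touches-sound (! y) x t = assigns-sound y x t
touches-sound {c} {σ} (V ⟦ r ∣ s ⟧) x t with ∨-false (writes c V) t
... | w , t′ with ∨-false (touches c r) t′
...   | tr , ts = trans (writes-sound V x w _ _)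
                        (cong₂ (tab σ V) (touches-sound r x tr) (touches-sound s x ts))
touches-sound {c} (d ⊕ e) x t = let l , r = ∨-false (touches c d) t in
  cong₂ _+ℤ_ (touches-sound d x l) (touches-sound e x r)
touches-sound {c} (d ⊖ e) x t = let l , r = ∨-false (touches c d) t in
  cong₂ _-ℤ_ (touches-sound d x l) (touches-sound e x r)
touches-sound {c} (d mod e) x t = let l , r = ∨-false (touches c d) t in
  cong₂ modℤ (touches-sound d x l) (touches-sound e x r)

-- Time credits

-- One credit pays for `unit` steps; every straight-line block and every test below fits into one.
opaque
  unit : ℕ
  unit = 100

  ≤-unit : ∀ t → T (t ≤ᵇ 100) → t ≤ unit
  ≤-unit t = ≤ᵇ⇒≤ t 100

  unit-cancel : ∀ {φ ψ} → unit * φ ≤ unit * ψ → φ ≤ ψ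
  unit-cancel = *-cancelˡ-≤ unit

Assertion : Set₁
Assertion = Store → ℕ → Set

-- After an early return only the bound on the running time matters.
IfFinished : Assertion → Outcome → Assertion
IfFinished P finished     = P
IfFinished P (returned _) = λ _ _ → ⊤

-- A total-correctness triple with a budget. The unspent `credit` is passed to the postcondition, so
-- what one block saves can finance the next; this is how amortised bounds travel through `seq` and
-- the loops.
record Run (c : Com) (σ : Store) (φ : ℕ) (P : Assertion) : Set where
  constructor run
  field
    {outcome} : Outcome
    {final}   : Store
    {time}    : ℕ
    {credit}  : ℕ
    execution : ⟨ c , σ ⟩⇓⟨ outcome , final ⟩in time
    paid      : time + unit * credit ≤ unit * φ
    post      : IfFinished P outcome final credit

credit≤ : ∀ {n φ φ′} → n + unit * φ′ ≤ unit * φ → φ′ ≤ φ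
credit≤ {n} h = unit-cancel (≤-trans (m≤n+m _ n) h)

pay : ∀ {t n φ φ′} → t ≤ unit → n + unit * φ′ ≤ unit * φ → (t + n) + unit * φ′ ≤ unit * suc φ
pay {t} {n} {φ} {φ′} t≤ h = begin
  (t + n) + unit * φ′  ≡⟨ +-assoc t n _ ⟩
  t + (n + unit * φ′)  ≤⟨ +-mono-≤ t≤ h ⟩
  unit + unit * φ      ≡⟨ *-suc unit φ ⟨
  unit * suc φ         ∎
  where open ≤-Reasoning

pay₁ : ∀ {t φ} → t ≤ unit → t + unit * φ ≤ unit * suc φ
pay₁ {t} {φ} t≤ = subst (λ s → s + unit * φ ≤ unit * suc φ) (+-identityʳ t) (pay {t} {0} t≤ ≤-refl)

weaken : ∀ {c σ φ ψ P} → φ ≤ ψ → Run c σ φ P → Run c σ ψ P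
weaken φ≤ψ (run e h p) = run e (≤-trans h (*-monoʳ-≤ unit φ≤ψ)) p

consequence : ∀ {c σ φ P Q} → (∀ {σ′ φ′} → P σ′ φ′ → Q σ′ φ′) → Run c σ φ P → Run c σ φ Q
consequence f (run {finished}   e h p) = run e h (f p)
consequence f (run {returned _} e h p) = run e h _

seq : ∀ {c d σ φ P} → Run c σ φ (λ σ′ φ′ → Run d σ′ φ′ P) → Run (c ︔ d) σ φ P
seq (run {returned _} e h p) = run (⇓-seq-return e) h _
seq {φ = φ} (run {finished} {time = n} {φ₁} e h (run {o} {time = n′} {φ₂} e′ h′ p)) = run (⇓-seq e e′) bound p
  where
  bound : (n + n′) + unit * φ₂ ≤ unit * φ
  bound = begin
    (n + n′) + unit * φ₂  ≡⟨ +-assoc n n′ _ ⟩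
    n + (n′ + unit * φ₂)  ≤⟨ +-monoʳ-≤ n h′ ⟩
    n + unit * φ₁         ≤⟨ h ⟩
    unit * φ              ∎
    where open ≤-Reasoning

-- Rules for straight-line blocks, branches and loops

straight? : Com → Bool
straight? skip             = true
straight? (_ ≔ _)          = true
straight? (_ ⟦ _ ∣ _ ⟧← _) = true
straight? (c ︔ d)          = straight? c ∧ straight? d
straight? _                = false

effect : Com → Store → Store
effect (y ≔ e)          σ = setVar y (evalᵉ e σ) σ
effect (V ⟦ r ∣ s ⟧← e) σ = setCell V (evalᵉ r σ) (evalᵉ s σ) (evalᵉ e σ) σ
effect (c ︔ d)          σ = effect d (effect c σ)
effect _                σ = σ

duration : Com → ℕ
duration (y ≔ e)          = suc (costᵉ e)
duration (V ⟦ r ∣ s ⟧← e) = suc (costᵉ r + costᵉ s + costᵉ e)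
duration (c ︔ d)          = duration c + duration d
duration _                = 0

effect-sound : ∀ c σ → straight? c ≡ true → ⟨ c , σ ⟩⇓⟨ finished , effect c σ ⟩in duration c
effect-sound skip             σ s = ⇓-skip
effect-sound (y ≔ e)          σ s = ⇓-assign
effect-sound (V ⟦ r ∣ t ⟧← e) σ s = ⇓-write
effect-sound (c ︔ d)          σ s =
  ⇓-seq (effect-sound c σ (∧-conicalˡ (straight? c) _ s)) (effect-sound d _ (∧-conicalʳ (straight? c) _ s))
effect-sound (cond _ _ _) σ ()
effect-sound (while _ _) σ ()
effect-sound (return _) σ ()
effect-sound (_ ≔call _) σ ()

-- The duration of a straight-line block does not depend on the store. For a concrete block both
-- side conditions reduce to `⊤` and are filled in silently, and the final store is computed by
-- `effect`.
straight : ∀ {c σ φ P} {_ : T (straight? c)} {_ : T (duration c ≤ᵇ 100)} →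
  P (effect c σ) φ → Run c σ (suc φ) P
straight {c} {σ} {_} {_} {s} {t} p =
  run (effect-sound c σ (Equivalence.to T-≡ s)) (pay₁ (≤-unit (duration c) t)) p

done : ∀ {σ φ P} → P σ φ → Run skip σ φ P
done p = run ⇓-skip ≤-refl p

leave : ∀ {e σ φ P} {_ : T (suc (costᵉ e) ≤ᵇ 100)} → Run (return e) σ (suc φ) P
leave {e} {φ = φ} {P} {t} = run {P = P} {credit = φ} ⇓-return (pay₁ (≤-unit (suc (costᵉ e)) t)) _

branch : ∀ {b c d σ φ P} {_ : T (suc (costᵇ b) ≤ᵇ 100)} →
  (evalᵇ b σ ≡ true → Run c σ φ P) → (evalᵇ b σ ≡ false → Run d σ φ P) →
  Run (cond b c d) σ (suc φ) P
branch {b} {c} {d} {σ} {φ} {P} {t} f g = select (evalᵇ b σ) refl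
  where
  enter : ∀ {x} → evalᵇ b σ ≡ x → Run (if x then c else d) σ φ P → Run (cond b c d) σ (suc φ) P
  enter refl (run e h p) = run (⇓-cond e) (pay (≤-unit (suc (costᵇ b)) t) h) p
  select : ∀ x → evalᵇ b σ ≡ x → Run (cond b c d) σ (suc φ) P
  select true  eq = enter eq (f eq)
  select false eq = enter eq (g eq)

-- `⇓-while` and `⇓-cond` charge the same, so an execution of the unrolled conditional becomes one
-- of the loop by exchanging the outermost rule.
unroll : ∀ {b c σ φ P} {_ : T (suc (costᵇ b) ≤ᵇ 100)} →
  (evalᵇ b σ ≡ true → Run (c ︔ while b c) σ φ P) → (evalᵇ b σ ≡ false → P σ φ) →
  Run (while b c) σ (suc φ) P
unroll {b} {c} {σ} {φ} {P} {t} f g = as-while (branch {_} {_} {_} {_} {_} {_} {t} f (λ eq → done (g eq)))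
  where
  as-while : Run (cond b (c ︔ while b c) skip) σ (suc φ) P → Run (while b c) σ (suc φ) P
  as-while (run (⇓-cond e) h p) = run (⇓-while e) h p

-- Every test of the loop condition consumes a credit, so credits bound the number of iterations.
loop : ∀ {b c} (I : Assertion) {_ : T (suc (costᵇ b) ≤ᵇ 100)} →
  (∀ {σ φ} → evalᵇ b σ ≡ true → I σ φ → Run c σ φ (λ σ′ φ′ → ∃[ ψ ] (suc ψ ≤ φ′ × I σ′ ψ))) →
  ∀ {σ φ} → I σ φ → Run (while b c) σ (suc φ) (λ σ′ φ′ → I σ′ φ′ × evalᵇ b σ′ ≡ false)
loop {b} {c} I {t} body {σ₀} {φ₀} i₀ = go φ₀ ≤-refl i₀
  where
  go : ∀ fuel {σ φ} → φ ≤ fuel → I σ φ → Run (while b c) σ (suc φ) (λ σ′ φ′ → I σ′ φ′ × evalᵇ b σ′ ≡ false)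
  step : ∀ fuel {σ φ} → φ ≤ fuel → Run c σ φ (λ σ′ φ′ → ∃[ ψ ] (suc ψ ≤ φ′ × I σ′ ψ)) →
    Run c σ φ (λ σ′ φ′ → Run (while b c) σ′ φ′ (λ σ′ φ′ → I σ′ φ′ × evalᵇ b σ′ ≡ false))
  step fuel le (run {returned _} e h p) = run e h _
  step zero le (run {finished} {time = n} e h (ψ , lt , i)) =
    contradiction (≤-trans lt (≤-trans (credit≤ {n} h) le)) λ ()
  step (suc fuel) le (run {finished} {time = n} e h (ψ , lt , i)) =
    run e h (weaken lt (go fuel (≤-pred (≤-trans lt (≤-trans (credit≤ {n} h) le))) i))
  go fuel {σ} {φ} le i = unroll {_} {_} {_} {_} {_} {t} (λ eq → seq (step fuel le (body eq i))) (λ eq → i , eq)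

-- A called block may return early, and then no postcondition survives. Hence the budget `ψ` of the
-- continuation is set aside beforehand, and facts about the final store are recovered from the
-- execution itself through the frame properties.
call : ∀ {y c σ φ ψ P} → Run c σ φ (λ _ _ → ⊤) →
  (∀ {o σ′ n} → ⟨ c , σ ⟩⇓⟨ o , σ′ ⟩in n → P (assignResult y o σ′) ψ) →
  Run (y ≔call c) σ (suc (φ + ψ)) P
call {φ = φ} {ψ} (run {time = n} {credit = φ′} e h _) k = run (⇓-call e) bound (k e)
  where
  bound : suc n + unit * ψ ≤ unit * suc (φ + ψ)
  bound = begin
    suc n + unit * ψ            ≤⟨ +-monoˡ-≤ (unit * ψ) (s≤s (≤-trans (m≤m+n n _) h)) ⟩
    1 + unit * φ + unit * ψ     ≡⟨ cong suc (*-distribˡ-+ unit φ ψ) ⟨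
    1 + unit * (φ + ψ)          ≤⟨ pay₁ {1} {φ + ψ} (≤-unit 1 tt) ⟩
    unit * suc (φ + ψ)          ∎
    where open ≤-Reasoning

-- Counting loops

infix 4 ∑
∑ : ℕ → (ℕ → ℕ) → ℕ
∑ n f = sum (applyUpTo f n)

syntax ∑ n (λ i → e) = ∑[ i < n ] e

-- The number of iterations of a loop from 0 below z.
trunc : ℤ → ℕ
trunc (+ n)    = n
trunc -[1+ _ ] = 0

<-true : ∀ y z {a} → y ≡ + a → not (z ℤ.≤ᵇ y) ≡ true → a < trunc z
<-true _ (+ b) {a} refl h with b ≤ᵇ a in eq
... | false = ≰⇒> λ b≤a → subst T eq (≤⇒≤ᵇ b≤a)
<-true _ -[1+ _ ] refl ()

<-false : ∀ y z {a} → y ≡ + a → not (z ℤ.≤ᵇ y) ≡ false → trunc z ≤ a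
<-false _ -[1+ _ ] refl h = z≤n
<-false _ (+ b) {a} refl h with b ≤ᵇ a in eq
... | true = ≤ᵇ⇒≤ b a (subst T (sym eq) tt)

-- The frame rule for credits: the budget `ψ` of later commands is carried past `c` untouched.
frame : ∀ {c σ φ P} ψ → Run c σ φ P → Run c σ (φ + ψ) (λ σ′ φ′ → ∃[ φ₁ ] (φ′ ≡ φ₁ + ψ × P σ′ φ₁))
frame {φ = φ} {P} ψ (run {o} {time = n} {φ′} e h p) = run e bound (post o p)
  where
  bound : n + unit * (φ′ + ψ) ≤ unit * (φ + ψ)
  bound = begin
    n + unit * (φ′ + ψ)         ≡⟨ cong (_+_ n) (*-distribˡ-+ unit φ′ ψ) ⟩
    n + (unit * φ′ + unit * ψ)  ≡⟨ +-assoc n _ _ ⟨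
    n + unit * φ′ + unit * ψ    ≤⟨ +-monoˡ-≤ _ h ⟩
    unit * φ + unit * ψ         ≡⟨ *-distribˡ-+ unit φ ψ ⟨
    unit * (φ + ψ)              ∎
    where open ≤-Reasoning
  post : ∀ {σ} o → IfFinished P o σ φ′ → IfFinished (λ σ′ φ″ → ∃[ φ₁ ] (φ″ ≡ φ₁ + ψ × P σ′ φ₁)) o σ (φ′ + ψ)
  post finished     p = φ′ , refl , p
  post (returned _) p = tt

keep : ∀ {c σ φ P} y → assigns c y ≡ false → Run c σ φ P →
  Run c σ φ (λ σ′ φ′ → P σ′ φ′ × var σ′ y ≡ var σ y)
keep y eq (run {finished}   e h p) = run e h (p , assigns-sound y e eq)
keep y eq (run {returned _} e h p) = run e h _

-- Credits known in advance for an iteration enter through `w`, amortised ones through the `φ` seen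
-- by the invariant. Of the two extra credits per iteration one pays the increment and one the test
-- after it; the two in front pay the assignment of `lo` and the first test. The invariant is
-- demanded with `y` already at its next value because that is the store in which the next iteration
-- starts.
forLoop : ∀ {y hi c} l n (w : ℕ → ℕ) (I : ℕ → Assertion) →
  touches c (! y) ≡ false → touches c hi ≡ false → (∀ z → touches (y ≔ lit z) hi ≡ false) →
  {_ : T (suc (costᵇ (! y <̇ hi)) ≤ᵇ 100)} →
  (∀ q {σ φ} → q < n → var σ y ≡ + (l + q) → I q σ φ →
    Run c σ (w q + φ) (λ σ′ φ′ → I (suc q) (setVar y (+ (l + suc q)) σ′) φ′)) →
  ∀ {σ φ} → trunc (evalᵉ hi σ) ≡ l + n → I 0 (setVar y (+ (l + 0)) σ) φ →
  Run (for y from lit (+ l) below hi do[ c ]) σ (2 + ((∑[ q < n ] 2 + w q) + φ)) (I n)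
forLoop {y} {hi} {c} l n w I cy chi yhi {t} body {σ} {φ} top i =
  seq (straight (go n 0 w (λ _ → refl) refl (trans (setVar-self _ σ) (cong +_ (sym (+-identityʳ l))))
    (trans (cong trunc (hi-setVar _ σ)) top)
    (subst (λ a → I 0 (setVar y (+ a) σ) φ) (+-identityʳ l) i)))
  where
  setVar-self : ∀ z σ → var (setVar y z σ) y ≡ z
  setVar-self z σ rewrite Equivalence.to T-≡ (≡⇒≡ᵇ (codeᵛ y) (codeᵛ y) refl) = refl
  hi-setVar : ∀ z σ → evalᵉ hi (setVar y z σ) ≡ evalᵉ hi σ
  hi-setVar z σ = touches-sound {y ≔ lit z} {σ} hi ⇓-assign (yhi z)
  body+ : Com
  body+ = c ︔ (y ≔ ! y ⊕ lit 1ℤ)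
  next : ∀ q {σ φ} ψ → var σ y ≡ + (l + q) → trunc (evalᵉ hi σ) ≡ l + n →
    Run c σ φ (λ σ′ φ′ → I (suc q) (setVar y (+ (l + suc q)) σ′) φ′) →
    Run body+ σ (φ + suc ψ) (λ σ′ φ′ → ∃[ φ₁ ] (φ′ ≡ φ₁ + ψ × I (suc q) σ′ φ₁ ×
      var σ′ y ≡ + (l + suc q) × trunc (evalᵉ hi σ′) ≡ l + n))
  next q {σ} {φ} ψ vy top r = seq (run-next (frame (suc ψ) r))
    where
    incremented : ∀ {σ′} → var σ′ y ≡ var σ y → var σ′ y +ℤ 1ℤ ≡ + (l + suc q)
    incremented eq = trans (cong (_+ℤ 1ℤ) (trans eq vy))
      (cong +_ (trans (+-assoc l q 1) (cong (_+_ l) (+-comm q 1))))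
    run-next : Run c σ (φ + suc ψ) (λ σ′ φ′ → ∃[ φ₁ ] (φ′ ≡ φ₁ + suc ψ × I (suc q) (setVar y (+ (l + suc q)) σ′) φ₁)) →
      Run c σ (φ + suc ψ) (λ σ′ φ′ → Run (y ≔ ! y ⊕ lit 1ℤ) σ′ φ′ _)
    run-next (run {returned _} e h _) = run e h _
    run-next (run {finished} {σ′} e h (φ₁ , refl , i)) = run e h (weaken (≤-reflexive (sym (+-suc φ₁ ψ)))
      (straight (φ₁ , refl , subst (λ z → I (suc q) (setVar y z σ′) φ₁) (sym inc) i ,
        trans (setVar-self _ σ′) inc ,
        trans (cong trunc (trans (hi-setVar _ σ′) (touches-sound hi e chi))) top)))
      where
      inc : var σ′ y +ℤ 1ℤ ≡ + (l + suc q)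
      inc = incremented {σ′} (assigns-sound y e cy)
  -- `∑` unfolds from the front, so the weights still to come are `w` shifted by the `q` iterations
  -- already made.
  go : ∀ d q (w′ : ℕ → ℕ) → (∀ r → w′ r ≡ w (q + r)) → ∀ {σ φ} → q + d ≡ n →
    var σ y ≡ + (l + q) → trunc (evalᵉ hi σ) ≡ l + n → I q σ φ →
    Run (while (! y <̇ hi) body+) σ (suc ((∑[ r < d ] 2 + w′ r) + φ)) (I n)
  go zero q w′ w≡ {σ} {φ} qd vy top i = unroll {φ = φ} {P = I n} {t}
    (λ eq → contradiction (<-true (var σ y) (evalᵉ hi σ) vy eq)
      (≤⇒≯ (≤-reflexive (trans top (cong (_+_ l) (trans (sym qd) (+-identityʳ q)))))))
    (λ _ → subst (λ m → I m σ φ) (trans (sym (+-identityʳ q)) qd) i)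
  go (suc d) q w′ w≡ {σ} {φ} qd vy top i = unroll {φ = 2 + w′ 0 + rest + φ} {P = I n} {t}
    (λ _ → seq (consequence
        (λ { (φ₁ , refl , i′ , vy′ , top′) → weaken
               (≤-reflexive (cong suc (+-comm rest φ₁)) ⟨≤⟩ ≤-reflexive (sym (+-suc φ₁ rest)))
               (go d (suc q) (w′ ∘ suc) (λ r → trans (w≡ (suc r)) (cong w (+-suc q r)))
                  (trans (sym (+-suc q d)) qd) vy′ top′ i′) })
        (weaken (≤-reflexive credits) (next q (suc rest) vy top (body q q<n vy i)))))
    (λ eq → contradiction (<-false (var σ y) (evalᵉ hi σ) vy eq)
      (<⇒≱ (subst (l + q <_) (sym top) (+-monoʳ-< l q<n))))
    where
    rest = ∑[ r < d ] 2 + w′ (suc r)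
    _⟨≤⟩_ = ≤-trans
    q<n : q < n
    q<n = subst (q <_) qd (m<m+n q (s≤s z≤n))
    credits : w q + φ + suc (suc rest) ≡ 2 + w′ 0 + rest + φ
    credits = trans (cong (λ x → x + φ + suc (suc rest)) (sym (trans (w≡ 0) (cong w (+-identityʳ q)))))
      (lemma (w′ 0) φ rest)
      where
      lemma : ∀ a b c → a + b + suc (suc c) ≡ 2 + a + c + b
      lemma = solve-∀

-- Finite sums

∑-mono : ∀ n {f g} → (∀ i → i < n → f i ≤ g i) → ∑ n f ≤ ∑ n g
∑-mono zero    h = z≤n
∑-mono (suc n) h = +-mono-≤ (h 0 (s≤s z≤n)) (∑-mono n λ i i<n → h (suc i) (s≤s i<n))

∑-cong : ∀ n {f g} → (∀ i → i < n → f i ≡ g i) → ∑ n f ≡ ∑ n g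
∑-cong zero    h = refl
∑-cong (suc n) h = cong₂ _+_ (h 0 (s≤s z≤n)) (∑-cong n λ i i<n → h (suc i) (s≤s i<n))

∑-const : ∀ n c → (∑[ _ < n ] c) ≡ n * c
∑-const zero    c = refl
∑-const (suc n) c = cong (_+_ c) (∑-const n c)

∑-distrib-+ : ∀ n f g → (∑[ i < n ] f i + g i) ≡ ∑ n f + ∑ n g
∑-distrib-+ zero    f g = refl
∑-distrib-+ (suc n) f g = trans (cong (_+_ (f 0 + g 0)) (∑-distrib-+ n (f ∘ suc) (g ∘ suc)))
  (interchange (f 0) (g 0) (∑ n (f ∘ suc)) (∑ n (g ∘ suc)))
  where
  interchange : ∀ a b c d → a + b + (c + d) ≡ a + c + (b + d)
  interchange = solve-∀

∑-distrib-* : ∀ n c f → (∑[ i < n ] c * f i) ≡ c * ∑ n f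
∑-distrib-* zero    c f = sym (*-zeroʳ c)
∑-distrib-* (suc n) c f = trans (cong (_+_ (c * f 0)) (∑-distrib-* n c (f ∘ suc))) (sym (*-distribˡ-+ c (f 0) _))

∑-suc : ∀ n f → ∑ (suc n) f ≡ ∑ n f + f n
∑-suc zero    f = +-identityʳ (f 0)
∑-suc (suc n) f = trans (cong (_+_ (f 0)) (∑-suc n (f ∘ suc))) (sym (+-assoc (f 0) _ _))

-- Free of subtraction: both sides are the common part of the sums plus `f x` and `g x`.
∑-update : ∀ n {x f g} → x < n → (∀ i → i < n → i ≢ x → f i ≡ g i) → ∑ n f + g x ≡ ∑ n g + f x
∑-update (suc n) {zero} {f} {g} (s≤s _) h =
  trans (cong (λ y → f 0 + y + g 0) (∑-cong n λ i i<n → h (suc i) (s≤s i<n) λ ()))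
        (swap (f 0) (∑ n (g ∘ suc)) (g 0))
  where
  swap : ∀ a b c → a + b + c ≡ c + b + a
  swap = solve-∀
∑-update (suc n) {suc x} {f} {g} (s≤s x<n) h = begin
  f 0 + ∑ n (f ∘ suc) + g (suc x)    ≡⟨ +-assoc (f 0) _ _ ⟩
  f 0 + (∑ n (f ∘ suc) + g (suc x))  ≡⟨ cong₂ _+_ (h 0 (s≤s z≤n) λ ())
                                         (∑-update n x<n λ i i<n i≢x → h (suc i) (s≤s i<n) (i≢x ∘ suc-injective)) ⟩
  g 0 + (∑ n (g ∘ suc) + f (suc x))  ≡⟨ +-assoc (g 0) _ _ ⟨
  g 0 + ∑ n (g ∘ suc) + f (suc x)    ∎
  where open ≡-Reasoning

∑-term : ∀ n f {x} → x < n → f x ≤ ∑ n f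
∑-term (suc n) f {zero}  _         = m≤m+n (f 0) _
∑-term (suc n) f {suc x} (s≤s x<n) = ≤-trans (∑-term n (f ∘ suc) x<n) (m≤n+m _ (f 0))

-- Tables and the bucket queue

Cells : Set
Cells = ℤ → ℤ → ℤ

infixl 8 _[_∣_↦_]
_[_∣_↦_] : Cells → ℤ → ℤ → ℤ → Cells
(f [ r ∣ c ↦ z ]) r′ c′ = if isYes (r ℤ.≟ r′) ∧ isYes (c ℤ.≟ c′) then z else f r′ c′

infix 9 _at_
_at_ : Cells → ℕ → ℤ
f at r = f (+ r) 0ℤ

write-hit : ∀ f r c z → (f [ r ∣ c ↦ z ]) r c ≡ z
write-hit f r c z with r ℤ.≟ r | c ℤ.≟ c
... | yes _   | yes _   = refl
... | no r≢r  | _       = contradiction refl r≢r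
... | yes _   | no c≢c  = contradiction refl c≢c

write-row : ∀ f {r r′} c z c′ → r ≢ r′ → (f [ r ∣ c ↦ z ]) r′ c′ ≡ f r′ c′
write-row f {r} {r′} c z c′ r≢r′ with r ℤ.≟ r′
... | yes r≡r′ = contradiction r≡r′ r≢r′
... | no _     = refl

write-column : ∀ f r c {c′} z r′ → c ≢ c′ → (f [ r ∣ c ↦ z ]) r′ c′ ≡ f r′ c′
write-column f r c {c′} z r′ c≢c′ with r ℤ.≟ r′ | c ℤ.≟ c′
... | _     | yes c≡c′ = contradiction c≡c′ c≢c′
... | yes _ | no _     = refl
... | no _  | no _     = refl

+≢ : ∀ {m n} → m ≢ n → + m ≢ + n
+≢ m≢n eq = m≢n (ℤ.+-injective eq)

at-hit : ∀ f r z → (f [ + r ∣ 0ℤ ↦ z ]) at r ≡ z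
at-hit f r z = write-hit f (+ r) 0ℤ z

at-row : ∀ f r {r′} z → r ≢ r′ → (f [ + r ∣ 0ℤ ↦ z ]) at r′ ≡ f at r′
at-row f r z r≢r′ = write-row f 0ℤ z 0ℤ (+≢ r≢r′)

-- Opaque, so that case distinctions do not rewrite the comparisons hidden in cell updates.
opaque
  _≡?_ : (a b : ℕ) → Dec (a ≡ b)
  _≡?_ = _≟_

-- `stored` and `located` make the bucket arrays and the position table mutually inverse on the
-- edges of non-negative size. A negative size means membership in no bucket, and cells at or beyond
-- a bucket's count may hold anything.
record Buckets (m n : ℕ) (B C P S : Cells) : Set where
  field
    counted : ∀ {s} → s < m → ∃[ c ] C at s ≡ + c
    stored  : ∀ {s c p} → s < m → C at s ≡ + c → p < c →
      ∃[ G ] (G < n × B (+ s) (+ p) ≡ + G × S at G ≡ + s × P at G ≡ + p)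
    located : ∀ {G s} → G < n → S at G ≡ + s → s < m ×
      ∃[ c ] ∃[ p ] (C at s ≡ + c × p < c × P at G ≡ + p × B (+ s) (+ p) ≡ + G)
open Buckets

+-inj : ∀ {m n z} → z ≡ + m → z ≡ + n → m ≡ n
+-inj eq eq′ = ℤ.+-injective (trans (sym eq) eq′)

-- The last entry `M` of the bucket fills the hole. If `M` is `G` itself, the writes concern the
-- position that the smaller count has just dropped, so they do no harm. The equations for `g` and
-- `r` let the statement match the terms to which the program evaluates.
remove : ∀ {m n B C P S S′ G s} → Buckets m n B C P S → G < n → S at G ≡ + s →
  (∀ s → S′ at G ≢ + s) → (∀ {H} → H ≢ G → S′ at H ≡ S at H) →
  ∀ {g r} → g ≡ + G → r ≡ + s →
  let slot = P g 0ℤ ; last = C r 0ℤ -ℤ 1ℤ ; moved = B r last in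
  Buckets m n (B [ r ∣ slot ↦ moved ]) (C [ r ∣ 0ℤ ↦ last ]) (P [ moved ∣ 0ℤ ↦ slot ]) S′
remove {m} {n} {B} {C} {P} {S} {S′} {G} {s} b G<n SG S′G S′≡S refl refl
  with located b G<n SG
... | s<m , suc c , slot , Cs , slot<c , PG , BG
  with stored b s<m Cs (n<1+n c)
... | M , M<n , BM , SM , PM = result
  where
  last≡ : C at s -ℤ 1ℤ ≡ + c
  last≡ = cong (_-ℤ 1ℤ) Cs
  moved≡ : B (+ s) (C at s -ℤ 1ℤ) ≡ + M
  moved≡ = trans (cong (B (+ s)) last≡) BM
  B′ = B [ + s ∣ + slot ↦ + M ]
  C′ = C [ + s ∣ 0ℤ ↦ + c ]
  P′ = P [ + M ∣ 0ℤ ↦ + slot ]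

  counted′ : ∀ {r} → r < m → ∃[ d ] C′ at r ≡ + d
  counted′ {r} r<m with s ≡? r
  ... | yes refl = c , at-hit C s _
  ... | no s≢r   = let d , eq = counted b r<m in d , trans (at-row C s _ s≢r) eq

  stored′ : ∀ {r d p} → r < m → C′ at r ≡ + d → p < d →
    ∃[ H ] (H < n × B′ (+ r) (+ p) ≡ + H × S′ at H ≡ + r × P′ at H ≡ + p)
  stored′ {r} {d} {p} r<m C′r p<d with s ≡? r
  ... | no s≢r with H , H<n , BH , SH , PH ← stored b r<m (trans (sym (at-row C s _ s≢r)) C′r) p<d =
    H , H<n , trans (write-row B _ _ _ (+≢ s≢r)) BH ,
    trans (S′≡S λ { refl → s≢r (+-inj SG SH) }) SH ,
    trans (at-row P M _ λ { refl → s≢r (+-inj SM SH) }) PH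
  ... | yes refl with +-inj (at-hit C s _) C′r
  ...   | refl with slot ≡? p
  ...     | yes refl = M , M<n , write-hit B _ _ _ ,
    trans (S′≡S λ { refl → <⇒≢ p<d (+-inj PG PM) }) SM , at-hit P M _
  ...     | no slot≢p with H , H<n , BH , SH , PH ← stored b s<m Cs (m<n⇒m<1+n p<d) =
    H , H<n , trans (write-column B (+ s) (+ slot) _ _ (+≢ slot≢p)) BH ,
    trans (S′≡S λ { refl → slot≢p (+-inj PG PH) }) SH ,
    trans (at-row P M _ λ { refl → <⇒≢ p<d (+-inj PH PM) }) PH

  located′ : ∀ {H r} → H < n → S′ at H ≡ + r → r < m ×
    ∃[ d ] ∃[ p ] (C′ at r ≡ + d × p < d × P′ at H ≡ + p × B′ (+ r) (+ p) ≡ + H)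
  located′ {H} {r} H<n S′H with H ≡? G
  ... | yes refl = contradiction S′H (S′G r)
  ... | no H≢G with SH ← trans (sym (S′≡S H≢G)) S′H with located b H<n SH
  ...   | r<m , d , p , Cr , p<d , PH , BH with s ≡? r
  ...     | no s≢r = r<m , d , p , trans (at-row C s _ s≢r) Cr , p<d ,
    trans (at-row P M _ λ { refl → s≢r (+-inj SM SH) }) PH , trans (write-row B _ _ _ (+≢ s≢r)) BH
  ...     | yes refl with M ≡? H
  -- The hole lies strictly below the last position, since otherwise `M` would be `G`.
  ...       | yes refl = s<m , c , slot , at-hit C s _ ,
    ≤∧≢⇒< (≤-pred slot<c) (λ { refl → H≢G (+-inj BM BG) }) , at-hit P M _ , write-hit B _ _ _
  ...       | no M≢H with refl ← +-inj Cs Cr = s<m , c , p , at-hit C s _ ,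
    ≤∧≢⇒< (≤-pred p<d) (λ { refl → M≢H (+-inj BM BH) }) , trans (at-row P M _ M≢H) PH ,
    trans (write-column B (+ s) (+ slot) _ _ (+≢ λ { refl → H≢G (+-inj BH BG) })) BH

  result : Buckets m n (B [ + s ∣ P at G ↦ B (+ s) (C at s -ℤ 1ℤ) ]) (C [ + s ∣ 0ℤ ↦ C at s -ℤ 1ℤ ])
    (P [ B (+ s) (C at s -ℤ 1ℤ) ∣ 0ℤ ↦ P at G ]) S′
  result rewrite moved≡ | last≡ | PG = record { counted = counted′ ; stored = stored′ ; located = located′ }

-- The program has written the new size before it inserts. In its use `S` is the table in which `G`
-- counts as retired and `S′` the actual one, so the view of the sizes changes together with the
-- arrays.
insert : ∀ {m n B C P S S′ G s} → Buckets m n B C P S → G < n → s < m →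
  (∀ s → S at G ≢ + s) → S′ at G ≡ + s → (∀ {H} → H ≢ G → S′ at H ≡ S at H) →
  ∀ {g r} → g ≡ + G → r ≡ + s →
  Buckets m n (B [ r ∣ C r 0ℤ ↦ g ]) (C [ r ∣ 0ℤ ↦ C r 0ℤ +ℤ 1ℤ ]) (P [ g ∣ 0ℤ ↦ C r 0ℤ ]) S′
insert {m} {n} {B} {C} {P} {S} {S′} {G} {s} b G<n s<m SG S′G S′≡S refl refl
  with c , Cs ← counted b s<m = result
  where
  B′ = B [ + s ∣ + c ↦ + G ]
  C′ = C [ + s ∣ 0ℤ ↦ + (c + 1) ]
  P′ = P [ + G ∣ 0ℤ ↦ + c ]

  counted′ : ∀ {r} → r < m → ∃[ d ] C′ at r ≡ + d
  counted′ {r} r<m with s ≡? r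
  ... | yes refl = c + 1 , at-hit C s _
  ... | no s≢r   = let d , eq = counted b r<m in d , trans (at-row C s _ s≢r) eq

  stored′ : ∀ {r d p} → r < m → C′ at r ≡ + d → p < d →
    ∃[ H ] (H < n × B′ (+ r) (+ p) ≡ + H × S′ at H ≡ + r × P′ at H ≡ + p)
  stored′ {r} {d} {p} r<m C′r p<d with s ≡? r
  ... | no s≢r with H , H<n , BH , SH , PH ← stored b r<m (trans (sym (at-row C s _ s≢r)) C′r) p<d =
    H , H<n , trans (write-row B _ _ _ (+≢ s≢r)) BH , trans (S′≡S λ { refl → SG _ SH }) SH ,
    trans (at-row P G _ λ { refl → SG _ SH }) PH
  ... | yes refl with refl ← +-inj (at-hit C s _) C′r with c ≡? p
  ...   | yes refl = G , G<n , write-hit B _ _ _ , S′G , at-hit P G _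
  ...   | no c≢p with H , H<n , BH , SH , PH ← stored b s<m Cs
                        (≤∧≢⇒< (≤-pred (subst (p <_) (+-comm c 1) p<d)) (c≢p ∘ sym)) =
    H , H<n , trans (write-column B (+ s) (+ c) _ _ (+≢ c≢p)) BH , trans (S′≡S λ { refl → SG _ SH }) SH ,
    trans (at-row P G _ λ { refl → SG _ SH }) PH

  located′ : ∀ {H r} → H < n → S′ at H ≡ + r → r < m ×
    ∃[ d ] ∃[ p ] (C′ at r ≡ + d × p < d × P′ at H ≡ + p × B′ (+ r) (+ p) ≡ + H)
  located′ {H} {r} H<n S′H with H ≡? G
  ... | yes refl with refl ← +-inj S′G S′H =
    s<m , c + 1 , c , at-hit C s _ , m<m+n c (s≤s z≤n) , at-hit P G _ , write-hit B _ _ _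
  ... | no H≢G with SH ← trans (sym (S′≡S H≢G)) S′H with located b H<n SH
  ...   | r<m , d , p , Cr , p<d , PH , BH with s ≡? r
  ...     | no s≢r = r<m , d , p , trans (at-row C s _ s≢r) Cr , p<d ,
    trans (at-row P G _ (H≢G ∘ sym)) PH , trans (write-row B _ _ _ (+≢ s≢r)) BH
  ...     | yes refl with refl ← +-inj Cs Cr =
    s<m , c + 1 , p , at-hit C s _ , ≤-trans p<d (m≤m+n c 1) ,
    trans (at-row P G _ (H≢G ∘ sym)) PH , trans (write-column B (+ s) (+ c) _ _ (+≢ (<⇒≢ p<d ∘ sym))) BH

  result : Buckets m n (B [ + s ∣ C at s ↦ + G ]) (C [ + s ∣ 0ℤ ↦ C at s +ℤ 1ℤ ]) (P [ + G ∣ 0ℤ ↦ C at s ]) S′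
  result rewrite Cs = record { counted = counted′ ; stored = stored′ ; located = located′ }

Buckets-cong : ∀ {m n B C P S S′} → (∀ H → S′ at H ≡ S at H) → Buckets m n B C P S → Buckets m n B C P S′
Buckets-cong S′≡S b = record
  { counted = counted b
  ; stored  = λ s<m Cs p<c → let G , G<n , BG , SG , PG = stored b s<m Cs p<c in
      G , G<n , BG , trans (S′≡S G) SG , PG
  ; located = λ {G} G<n S′G → located b G<n (trans (sym (S′≡S G)) S′G)
  }

uniformLoop : ∀ {y hi c} l n w (I : ℕ → Assertion) →
  touches c (! y) ≡ false → touches c hi ≡ false → (∀ z → touches (y ≔ lit z) hi ≡ false) →
  {_ : T (suc (costᵇ (! y <̇ hi)) ≤ᵇ 100)} →
  (∀ q {σ φ} → q < n → var σ y ≡ + (l + q) → I q σ φ →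
    Run c σ (w + φ) (λ σ′ φ′ → I (suc q) (setVar y (+ (l + suc q)) σ′) φ′)) →
  ∀ {σ φ} → trunc (evalᵉ hi σ) ≡ l + n → I 0 (setVar y (+ (l + 0)) σ) φ →
  Run (for y from lit (+ l) below hi do[ c ]) σ (2 + (n * (2 + w) + φ)) (I n)
uniformLoop {y} {hi} {c} l n w I cy chi yhi {t} body {σ} {φ} top i =
  subst (λ s → Run (for y from lit (+ l) below hi do[ c ]) σ (2 + (s + φ)) (I n)) (∑-const n (2 + w))
    (forLoop l n (λ _ → w) I cy chi yhi {t} (λ q q<n y≡ → body q q<n y≡) top i)

≤-true : ∀ z → (0ℤ ℤ.≤ᵇ z) ≡ true → ∃[ s ] z ≡ + s
≤-true (+ s) _ = s , refl

≟-true : ∀ {y z : ℤ} → isYes (y ℤ.≟ z) ≡ true → y ≡ z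
≟-true {y} {z} h with y ℤ.≟ z
... | yes eq = eq

≟-false : ∀ {y z : ℤ} → isYes (y ℤ.≟ z) ≡ false → y ≢ z
≟-false {y} {z} h with y ℤ.≟ z
... | no y≢z = y≢z

ifNonneg : ℤ → ℕ → ℕ
ifNonneg (+ _)    w = w
ifNonneg -[1+ _ ] w = 0

ifZero : ℤ → ℕ → ℕ
ifZero (+ 0)     w = w
ifZero (+ suc _) w = 0
ifZero -[1+ _ ]  w = 0

ifNonneg-≤ : ∀ z w → ifNonneg z w ≤ w
ifNonneg-≤ (+ _)    w = ≤-refl
ifNonneg-≤ -[1+ _ ] w = z≤n

ifZero-≤ : ∀ z w → ifZero z w ≤ w
ifZero-≤ (+ 0)     w = ≤-refl
ifZero-≤ (+ suc _) w = z≤n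
ifZero-≤ -[1+ _ ]  w = z≤n

-- The number of values of j from the current one down to 0.
height : ℤ → ℕ
height (+ j)    = suc j
height -[1+ _ ] = 0

height-≤ : ∀ y z → (y ℤ.≤ᵇ z) ≡ true → height y ≤ height z
height-≤ (+ a) (+ b) h = s≤s (≤ᵇ⇒≤ a b (subst T (sym h) tt))
height-≤ -[1+ _ ] z h = z≤n

height-≥ : ∀ y z → (y ℤ.≤ᵇ z) ≡ false → height z ≤ height y
height-≥ y -[1+ _ ] h = z≤n
height-≥ (+ a) (+ b) h = s≤s (≮⇒≥ λ a<b → subst T h (≤⇒≤ᵇ (<⇒≤ a<b)))

not-true : ∀ {x} → not x ≡ true → x ≡ false
not-true {false} _ = refl

not-false : ∀ {x} → not x ≡ false → x ≡ true
not-false {true} _ = refl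

-- With `height`, j = -1 needs no separate case: `s < height j` reads s ≤ j, and `height≤` keeps a
-- non-negative j a legal bucket index.
record Queue (m n : ℕ) (j : ℤ) (B C P S : Cells) : Set where
  field
    buckets : Buckets m n B C P S
    height≤ : height j ≤ m
    sizes<  : ∀ {G s} → G < n → S at G ≡ + s → s < height j
open Queue

negative : ∀ {z} → (∀ s → z ≢ + s) → ∀ w → ifNonneg z w ≡ 0
negative {+ s}      h w = contradiction refl (h s)
negative { -[1+ _ ]} h w = refl

fill : ∀ f {r z c} → z ≡ + r → (∀ {x} → x < r → f at x ≡ c) → ∀ {x} → x < suc r → (f [ z ∣ 0ℤ ↦ c ]) at x ≡ c
fill f {r} refl h {x} x<1+r with r ≡? x
... | yes refl = at-hit f r _
... | no r≢x   = trans (at-row f r _ r≢x) (h (≤∧≢⇒< (≤-pred x<1+r) (r≢x ∘ sym)))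

nonzero : ∀ {n z} → 0 < n → z ≡ + n → ∃[ c ] z ≡ + suc c
nonzero {suc n} _ eq = n , eq

-- Initialisation, search and test

module Acyclicity (m n : ℕ) (slen elen : ℕ → ℕ) where

  -- Invariants are stated about individual registers and tables instead of stores: a command that
  -- modifies other components leaves the statement definitionally unchanged, so its proof is passed
  -- on as it is. The bound `elen≤m` keeps every queued size below m, the number of initialised
  -- buckets.
  record InputCells (#m #n : ℤ) (SL ST EL ET : Cells) : Set where
    field
      #m≡      : #m ≡ + m
      #n≡      : #n ≡ + n
      setLen≡  : ∀ {v} → v < m → SL at v ≡ + slen v
      sets∈    : ∀ {v q} → v < m → q < slen v → ∃[ G ] (G < n × ST (+ v) (+ q) ≡ + G)
      edgeLen≡ : ∀ {G} → G < n → EL at G ≡ + elen G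
      edges∈   : ∀ {G p} → G < n → p < elen G → ∃[ v ] (v < m × ET (+ G) (+ p) ≡ + v)
      elen≤m   : ∀ {G} → G < n → elen G ≤ m
  open InputCells

  Input : Store → Set
  Input σ = InputCells (var σ #m) (var σ #n) (tab σ setLen) (tab σ sets) (tab σ edgeLen) (tab σ edges)

  -- Weights, invariants and the potential

  liveWeight : Cells → ℕ
  liveWeight S = ∑[ G < n ] ifNonneg (S at G) (suc (elen G))

  unnumbered : Cells → ℕ
  unnumbered A = ∑[ v < m ] ifZero (A at v) 1

  unnumberedWeight : Cells → ℕ
  unnumberedWeight A = ∑[ v < m ] ifZero (A at v) (suc (slen v))

  edgeWeight : Cells → ℤ → ℕ
  edgeWeight EL g = suc (trunc (EL g 0ℤ))

  totalWeight : ℕ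
  totalWeight = ∑[ G < n ] suc (elen G)

  -- The form in which the test uses that R(1),...,R(k) are different edges: their weights and those
  -- of the edges still queued fit together into the total. It is an inequality because an edge
  -- whose vertices have all been numbered leaves the queue without being visited.
  Visits : ℤ → Cells → Cells → Cells → Set
  Visits k EL Rt S = ∃[ K ] (k ≡ + K × (∑[ x < K ] edgeWeight EL (Rt at suc x)) + liveWeight S ≤ totalWeight)

  -- `numbering` keeps the values given to `α` positive, so that a numbered vertex is never mistaken
  -- for an unnumbered one and releases its credits only once.
  record SearchCells (i j k : ℤ) (EL B C P S A Rt : Cells) : Set where
    field
      queue     : Queue m n j B C P S
      numbering : i ≡ + suc (unnumbered A)
      visits    : Visits k EL Rt S
  open SearchCells

  -- The credits held by the edges still in the queue, the unnumbered vertices and j.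
  potential : ℤ → Cells → Cells → ℕ
  potential j S A = 16 * liveWeight S + 16 * unnumberedWeight A + 2 * height j

  -- G has size s but is in none of the buckets, which therefore see it as retired.
  record DetachedCells (G s : ℕ) (i j k : ℤ) (EL B C P S A Rt : Cells) : Set where
    field
      G<n       : G < n
      others    : Buckets m n B C P (S [ + G ∣ 0ℤ ↦ -1ℤ ])
      height≤   : height j ≤ m
      sizes<    : ∀ {H r} → H < n → H ≢ G → S at H ≡ + r → r < height j
      size≡     : S at G ≡ + s
      numbering : i ≡ + suc (unnumbered A)
      visits    : Visits k EL Rt S
  open DetachedCells hiding (height≤; sizes<; numbering; visits)

  creditNeeded : Store → ℕ
  creditNeeded σ = potential (var σ Var.j) (tab σ size) (tab σ α)

  SearchState : Store → Set
  SearchState σ = SearchCells (var σ Var.i) (var σ Var.j) (var σ Var.k) (tab σ edgeLen)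
    (tab σ bucket) (tab σ card) (tab σ pos) (tab σ size) (tab σ α) (tab σ R)

  DetachedState : ℕ → ℕ → Store → Set
  DetachedState G s σ = DetachedCells G s (var σ Var.i) (var σ Var.j) (var σ Var.k) (tab σ edgeLen)
    (tab σ bucket) (tab σ card) (tab σ pos) (tab σ size) (tab σ α) (tab σ R)

  Searching : Assertion
  Searching σ φ = Input σ × SearchState σ × creditNeeded σ ≤ φ

  Detached : ℕ → ℕ → Assertion
  Detached G s σ φ = Input σ × DetachedState G s σ × creditNeeded σ ≤ φ

  -- The size s of G may still exceed j.
  Reattached : ℕ → ℕ → Assertion
  Reattached G s σ φ = Input σ × tab σ size at G ≡ + s ×
    (∀ j′ → height (var σ Var.j) ≤ height j′ → height j′ ≤ m → s < height j′ →
      SearchState (setVar Var.j j′ σ)) ×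
    creditNeeded σ ≤ φ

  -- Moving an edge between buckets and retiring it

  liveWeight-≤ : ∀ S S′ {G s} → S at G ≡ + s → (∀ {H} → H ≢ G → S′ at H ≡ S at H) → liveWeight S′ ≤ liveWeight S
  liveWeight-≤ S S′ {G} SG S′≡S = ∑-mono n λ H _ → at-edge H
    where
    at-edge : ∀ H → ifNonneg (S′ at H) (suc (elen H)) ≤ ifNonneg (S at H) (suc (elen H))
    at-edge H with H ≡? G
    ... | yes refl rewrite SG = ifNonneg-≤ (S′ at H) _
    ... | no H≢G   = ≤-reflexive (cong (λ z → ifNonneg z (suc (elen H))) (S′≡S H≢G))

  liveWeight-retire : ∀ S S′ {G s} → G < n → S at G ≡ + s →
    (∀ s → S′ at G ≢ + s) → (∀ {H} → H ≢ G → S′ at H ≡ S at H) →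
    liveWeight S′ + suc (elen G) ≡ liveWeight S
  liveWeight-retire S S′ {G} G<n SG S′G S′≡S = begin
    liveWeight S′ + suc (elen G)                       ≡⟨ cong (λ z → liveWeight S′ + ifNonneg z (suc (elen G))) SG ⟨
    liveWeight S′ + ifNonneg (S at G) (suc (elen G))   ≡⟨ ∑-update n G<n (λ H _ H≢G →
                                                            cong (λ z → ifNonneg z (suc (elen H))) (S′≡S H≢G)) ⟩
    liveWeight S + ifNonneg (S′ at G) (suc (elen G))   ≡⟨ cong (_+_ (liveWeight S)) (negative S′G _) ⟩
    liveWeight S + 0                                   ≡⟨ +-identityʳ _ ⟩
    liveWeight S                                       ∎
    where open ≡-Reasoning

  Visits-≤ : ∀ {k} EL Rt S S′ → liveWeight S′ ≤ liveWeight S → Visits k EL Rt S → Visits k EL Rt S′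
  Visits-≤ EL Rt S S′ S′≤S (K , k≡ , h) = K , k≡ , ≤-trans (+-monoʳ-≤ _ S′≤S) h

  -- The weight of `G` leaves the live sum and becomes the last term of the visited sum; the new row
  -- of `R` lies beyond the rows already counted.
  visit : ∀ {k EL Rt S S′ G s} → Visits k EL Rt S → G < n → EL at G ≡ + elen G → S at G ≡ + s →
    (∀ s → S′ at G ≢ + s) → (∀ {H} → H ≢ G → S′ at H ≡ S at H) →
    ∀ {g} → g ≡ + G → Visits (k +ℤ 1ℤ) EL (Rt [ k +ℤ 1ℤ ∣ 0ℤ ↦ g ]) S′
  visit {EL = EL} {Rt} {S} {S′} {G} (K , refl , h) G<n ELG SG S′G S′≡S refl rewrite +-comm K 1 =
    suc K , refl , (begin
      (∑[ x < suc K ] edgeWeight EL (Rt′ at suc x)) + liveWeight S′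
        ≡⟨ cong (_+ liveWeight S′) (∑-suc K _) ⟩
      (∑[ x < K ] edgeWeight EL (Rt′ at suc x)) + edgeWeight EL (Rt′ at suc K) + liveWeight S′
        ≡⟨ cong₂ (λ a b → a + b + liveWeight S′)
             (∑-cong K λ x x<K → cong (edgeWeight EL) (at-row Rt (suc K) _ (<⇒≢ (s≤s x<K) ∘ sym)))
             (trans (cong (edgeWeight EL) (at-hit Rt (suc K) _)) (cong (suc ∘ trunc) ELG)) ⟩
      (∑[ x < K ] edgeWeight EL (Rt at suc x)) + suc (elen G) + liveWeight S′
        ≡⟨ trans (+-assoc _ (suc (elen G)) _) (cong (_+_ (∑[ x < K ] edgeWeight EL (Rt at suc x)))
             (trans (+-comm (suc (elen G)) _) (liveWeight-retire S S′ G<n SG S′G S′≡S))) ⟩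
      (∑[ x < K ] edgeWeight EL (Rt at suc x)) + liveWeight S
        ≤⟨ h ⟩
      totalWeight ∎)
    where
    open ≤-Reasoning
    Rt′ = Rt [ + suc K ∣ 0ℤ ↦ + G ]

  -- Whatever integer the oracle holds, its remainder modulo a positive count is an occupied
  -- position, so every way of choosing is covered.
  chosen : ∀ {j B C P S J c} o → Queue m n j B C P S → j ≡ + J → C at J ≡ + suc c →
    ∃[ G ] (G < n × B j (modℤ o (C j 0ℤ)) ≡ + G × S at G ≡ + J)
  chosen {c = c} o queue refl CJ rewrite CJ
    with G , G<n , BG , SG , _ ← stored (buckets queue) (height≤ queue) CJ (n%ℕd<d o (suc c))
    = G , G<n , BG , SG

  detach : ∀ {i j k EL B C P S A Rt G s g r} → SearchCells i j k EL B C P S A Rt →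
    G < n → S at G ≡ + s → g ≡ + G → r ≡ + s →
    let slot = P g 0ℤ ; last = C r 0ℤ -ℤ 1ℤ ; moved = B r last in
    DetachedCells G s i j k EL (B [ r ∣ slot ↦ moved ]) (C [ r ∣ 0ℤ ↦ last ]) (P [ moved ∣ 0ℤ ↦ slot ]) S A Rt
  detach {S = S} {G = G} cells G<n SG g≡ r≡ = record
    { G<n       = G<n
    ; others    = remove (buckets (queue cells)) G<n SG
        (λ s eq → case trans (sym (at-hit S G -1ℤ)) eq of λ ()) (λ H≢G → at-row S G -1ℤ (H≢G ∘ sym)) g≡ r≡
    ; height≤   = height≤ (queue cells)
    ; sizes<    = λ H<n _ → sizes< (queue cells) H<n
    ; size≡     = SG
    ; numbering = numbering cells
    ; visits    = visits cells
    }

  run-detach-F : ∀ {G s σ φ} → Searching σ φ → G < n → var σ Var.F ≡ + G → tab σ size at G ≡ + s →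
    Run (delete Var.F from size ⟦ ! Var.F ⟧) σ (suc φ) (λ σ′ φ′ → Detached G s σ′ φ′ × s < height (var σ′ Var.j))
  run-detach-F {σ = σ} (input , cells , credit) G<n g≡ SG =
    straight ((input , detach cells G<n SG g≡ (trans (cong (λ z → tab σ size z 0ℤ) g≡) SG) , credit) ,
              sizes< (queue cells) G<n SG)

  resize : ∀ {i j k EL B C P S A Rt G s} t → DetachedCells G s i j k EL B C P S A Rt →
    ∀ {g z} → g ≡ + G → z ≡ + t → DetachedCells G t i j k EL B C P (S [ g ∣ 0ℤ ↦ z ]) A Rt
  resize {EL = EL} {S = S} {Rt = Rt} {G = G} t cells refl refl = record
    { G<n       = G<n cells
    ; others    = Buckets-cong same (others cells)
    ; height≤   = DetachedCells.height≤ cells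
    ; sizes<    = λ H<n H≢G eq → DetachedCells.sizes< cells H<n H≢G (trans (sym (at-row S G _ (H≢G ∘ sym))) eq)
    ; size≡     = at-hit S G _
    ; numbering = DetachedCells.numbering cells
    ; visits    = Visits-≤ EL Rt S S′
        (liveWeight-≤ S S′ (size≡ cells) λ H≢G → at-row S G _ (H≢G ∘ sym)) (DetachedCells.visits cells)
    }
    where
    S′ = S [ + G ∣ 0ℤ ↦ + t ]
    -- The buckets see `G` as retired whatever its size, so the write is invisible to them.
    same : ∀ H → (S [ + G ∣ 0ℤ ↦ + t ] [ + G ∣ 0ℤ ↦ -1ℤ ]) at H ≡ (S [ + G ∣ 0ℤ ↦ -1ℤ ]) at H
    same H with H ≡? G
    ... | yes refl = trans (at-hit (S [ + G ∣ 0ℤ ↦ + t ]) G -1ℤ) (sym (at-hit S G -1ℤ))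
    ... | no H≢G   = trans (at-row (S [ + G ∣ 0ℤ ↦ + t ]) G -1ℤ (H≢G ∘ sym))
      (trans (at-row S G _ (H≢G ∘ sym)) (sym (at-row S G -1ℤ (H≢G ∘ sym))))

  potential-≤ : ∀ j j′ S S′ A {d} → liveWeight S′ ≤ liveWeight S → height j′ ≤ d + height j →
    potential j′ S′ A ≤ d * 2 + potential j S A
  potential-≤ j j′ S S′ A {d} S′≤S j′≤j = ≤-trans
    (+-mono-≤ (+-monoˡ-≤ _ (*-monoʳ-≤ 16 S′≤S)) (*-monoʳ-≤ 2 j′≤j))
    (≤-reflexive (lemma (16 * liveWeight S + 16 * unnumberedWeight A) d (height j)))
    where
    lemma : ∀ a d b → a + 2 * (d + b) ≡ d * 2 + (a + 2 * b)
    lemma = solve-∀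

  run-resize : ∀ {G s σ φ} → Detached G s σ φ → var σ Var.F ≡ + G →
    Run (size ⟦ ! Var.F ⟧← size ⟦ ! Var.F ⟧ ⊕ lit 1ℤ) σ (suc φ) (Detached G (suc s))
  run-resize {G} {s} {σ} {φ} (input , cells , credit) g≡ = straight
    (input ,
     resize (suc s) cells g≡ z≡ ,
     ≤-trans (potential-≤ (var σ Var.j) (var σ Var.j) (tab σ size) (tab σ size [ var σ Var.F ∣ 0ℤ ↦ z ]) (tab σ α) {0}
       (liveWeight-≤ (tab σ size) (tab σ size [ var σ Var.F ∣ 0ℤ ↦ z ]) (size≡ cells)
         (λ H≢G → write-row (tab σ size) 0ℤ z 0ℤ (λ eq → H≢G (+-inj eq g≡))))
       ≤-refl) credit)
    where
    z = tab σ size (var σ Var.F) 0ℤ +ℤ 1ℤ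
    z≡ : z ≡ + suc s
    z≡ = trans (cong (_+ℤ 1ℤ) (trans (cong (λ g → tab σ size g 0ℤ) g≡) (size≡ cells))) (cong +_ (+-comm s 1))

  run-attach : ∀ {G s σ φ} → Detached G s σ φ → s < m → var σ Var.F ≡ + G →
    Run (add Var.F to size ⟦ ! Var.F ⟧) σ (suc φ) (Reattached G s)
  run-attach {G} {s} {σ} {φ} (input , cells , credit) s<m g≡ = straight
    (input , size≡ cells , reattach , credit)
    where
    S = tab σ size
    buckets′ = insert (others cells) (G<n cells) s<m
      (λ s eq → case trans (sym (at-hit S G -1ℤ)) eq of λ ())
      (size≡ cells) (λ H≢G → sym (at-row S G -1ℤ (H≢G ∘ sym)))
      g≡ (trans (cong (λ z → S z 0ℤ) g≡) (size≡ cells))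
    reattach : ∀ j′ → height (var σ Var.j) ≤ height j′ → height j′ ≤ m → s < height j′ → _
    reattach j′ j≤j′ j′≤m s<j′ = record
      { queue = record
        { buckets = buckets′
        ; height≤ = j′≤m
        ; sizes<  = sizes<′
        }
      ; numbering = DetachedCells.numbering cells
      ; visits    = DetachedCells.visits cells
      }
      where
      sizes<′ : ∀ {H r} → H < n → S at H ≡ + r → r < height j′
      sizes<′ {H} H<n SH with H ≡? G
      ... | yes refl = subst (_< height j′) (+-inj (size≡ cells) SH) s<j′
      ... | no H≢G   = ≤-trans (DetachedCells.sizes< cells H<n H≢G SH) j≤j′

  -- Before its increment the size was at most j, so j rises by at most one level. Of the four
  -- credits one pays the test, one the assignment, and two become the potential of the new level.
  run-raise : ∀ {G s σ φ} → Reattached G s σ φ → s < m → s ≤ height (var σ Var.j) → height (var σ Var.j) ≤ m →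
    var σ Var.F ≡ + G →
    Run (when ! Var.j <̇ size ⟦ ! Var.F ⟧ then (Var.j ≔ size ⟦ ! Var.F ⟧)) σ (4 + φ) Searching
  run-raise {G} {s} {σ} {φ} (input , SG , reattach , credit) s<m s≤j j≤m g≡ = branch up stay
    where
    j = var σ Var.j
    z = tab σ size (var σ Var.F) 0ℤ
    z≡ : z ≡ + s
    z≡ = trans (cong (λ g → tab σ size g 0ℤ) g≡) SG
    height≡ : height z ≡ suc s
    height≡ = cong height z≡
    up : not (z ℤ.≤ᵇ j) ≡ true → Run _ _ (3 + φ) _
    up h = straight (input ,
      reattach z (height-≥ z j (not-true h)) (subst (_≤ m) (sym height≡) s<m) (≤-reflexive (sym height≡)) ,
      ≤-trans (potential-≤ j z (tab σ size) (tab σ size) (tab σ α) {1} ≤-refl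
        (subst (_≤ suc (height j)) (sym height≡) (s≤s s≤j)))
        (+-monoʳ-≤ 2 credit))
    stay : not (z ℤ.≤ᵇ j) ≡ false → Run _ _ (3 + φ) _
    stay h = done (input , reattach j ≤-refl j≤m (subst (_≤ height j) height≡ (height-≤ z j (not-false h))) ,
      ≤-trans credit (m≤n+m φ 3))

  -- Shared by the two ways of leaving the queue. A chosen edge is entered into `R` and a full one
  -- is not, hence the separate argument for `visits`.
  retire : ∀ {i j k EL B C P S A Rt G s g} → DetachedCells G s i j k EL B C P S A Rt → g ≡ + G →
    ∀ {k′ Rt′} → Visits k′ EL Rt′ (S [ g ∣ 0ℤ ↦ -1ℤ ]) →
    SearchCells i j k′ EL B C P (S [ g ∣ 0ℤ ↦ -1ℤ ]) A Rt′
  retire {S = S} {G = G} cells refl visits′ = record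
    { queue     = record
      { buckets = others cells
      ; height≤ = DetachedCells.height≤ cells
      ; sizes<  = sizes<′
      }
    ; numbering = DetachedCells.numbering cells
    ; visits    = visits′
    }
    where
    sizes<′ : ∀ {H r} → H < n → (S [ + G ∣ 0ℤ ↦ -1ℤ ]) at H ≡ + r → r < _
    sizes<′ {H} H<n S′H with H ≡? G
    ... | yes refl = case trans (sym (at-hit S G -1ℤ)) S′H of λ ()
    ... | no H≢G   = DetachedCells.sizes< cells H<n H≢G (trans (sym (at-row S G -1ℤ (H≢G ∘ sym))) S′H)

  run-retire-F : ∀ {G s σ φ} → Detached G s σ φ → var σ Var.F ≡ + G →
    Run (size ⟦ ! Var.F ⟧← lit -1ℤ) σ (suc φ) Searching
  run-retire-F {G} {s} {σ} {φ} (input , cells , credit) g≡ = straight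
    (input , retire cells g≡ (Visits-≤ (tab σ edgeLen) (tab σ R) S S′ S′≤S (DetachedCells.visits cells)) ,
     ≤-trans (potential-≤ (var σ Var.j) (var σ Var.j) S S′ (tab σ α) {0} S′≤S ≤-refl) credit)
    where
    S = tab σ size
    S′ = S [ var σ Var.F ∣ 0ℤ ↦ -1ℤ ]
    S′≤S : liveWeight S′ ≤ liveWeight S
    S′≤S = liveWeight-≤ S S′ (size≡ cells) λ H≢G → write-row S 0ℤ -1ℤ 0ℤ λ eq → H≢G (+-inj eq g≡)

  settle : Com
  settle = cond (size ⟦ ! Var.F ⟧ <̇ edgeLen ⟦ ! Var.F ⟧)
    (add Var.F to size ⟦ ! Var.F ⟧ ︔
     (when ! Var.j <̇ size ⟦ ! Var.F ⟧ then (Var.j ≔ size ⟦ ! Var.F ⟧)))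
    (size ⟦ ! Var.F ⟧← lit -1ℤ)

  run-settle : ∀ {G s σ φ} → Detached G s σ φ → s ≤ height (var σ Var.j) → var σ Var.F ≡ + G →
    Run settle σ (6 + φ) Searching
  run-settle {G} {s} {σ} {φ} det@(input , cells , credit) s≤j g≡ = branch room full
    where
    g = var σ Var.F
    room : not (tab σ edgeLen g 0ℤ ℤ.≤ᵇ tab σ size g 0ℤ) ≡ true → Run _ σ (5 + φ) Searching
    room h = seq (weaken (≤-reflexive (cong suc (+-comm φ 4))) (consequence
      (λ { ((((φ₁ , refl , re) , F≡) , j≡)) → weaken (≤-reflexive (+-comm 4 φ₁)) (run-raise re s<m
             (subst (λ j → s ≤ height j) (sym j≡) s≤j)
             (subst (λ j → height j ≤ m) (sym j≡) (DetachedCells.height≤ cells)) (trans F≡ g≡)) })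
      (keep Var.j refl (keep Var.F refl (frame 4 (run-attach det s<m g≡))))))
      where
      -- Only a size below |F| is queued, and |F| ≤ m, so the target bucket is an initialised one.
      s<m : s < m
      s<m = ≤-trans (<-true (tab σ size g 0ℤ) (tab σ edgeLen g 0ℤ)
                       (trans (cong (λ z → tab σ size z 0ℤ) g≡) (size≡ cells)) h)
        (≤-trans (≤-reflexive (cong trunc (trans (cong (λ z → tab σ edgeLen z 0ℤ) g≡) (edgeLen≡ input (G<n cells)))))
                 (elen≤m input (G<n cells)))
    full : not (tab σ edgeLen g 0ℤ ℤ.≤ᵇ tab σ size g 0ℤ) ≡ false → Run _ σ (5 + φ) Searching
    full _ = weaken (m≤n+m (suc φ) 4) (run-retire-F det g≡)

  advance : Com
  advance = when lit 0ℤ ≤̇ size ⟦ ! Var.F ⟧ then (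
    (γ ⟦ ! Var.F ⟧← ! Var.k) ︔
    delete Var.F from size ⟦ ! Var.F ⟧ ︔
    (size ⟦ ! Var.F ⟧← size ⟦ ! Var.F ⟧ ⊕ lit 1ℤ) ︔
    settle)

  -- Ten credits: one each for the test, the mark in `γ`, the deletion and the increment, and six
  -- for `settle`.
  run-advance : ∀ {G σ φ} → Searching σ φ → G < n → var σ Var.F ≡ + G →
    Run advance σ (10 + φ) Searching
  run-advance {G} {σ} {φ} search@(input , cells , credit) G<n g≡ =
    branch live (λ _ → done (input , cells , ≤-trans credit (m≤n+m φ 9)))
    where
    live : (0ℤ ℤ.≤ᵇ tab σ size (var σ Var.F) 0ℤ) ≡ true → Run _ σ (9 + φ) Searching
    live h with s , r≡ ← ≤-true _ h =
      seq (straight (seq (weaken (≤-reflexive (cong suc (+-comm φ 7))) (consequence detached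
        (keep Var.F refl (frame 7 (run-detach-F {σ = setCell γ (var σ Var.F) 0ℤ (var σ Var.k) σ} search G<n g≡
          (trans (cong (λ z → tab σ size z 0ℤ) (sym g≡)) r≡))))))))
      where
      resized : ∀ σ₁ {σ₂ φ₂} → var σ₁ Var.F ≡ + G → s < height (var σ₁ Var.j) →
        ((∃[ φ₃ ] (φ₂ ≡ φ₃ + 6 × Detached G (suc s) σ₂ φ₃)) × var σ₂ Var.F ≡ var σ₁ Var.F) × var σ₂ Var.j ≡ var σ₁ Var.j →
        Run settle σ₂ φ₂ Searching
      resized σ₁ F≡ s<j (((φ₃ , refl , det) , F≡′) , j≡) =
        weaken (≤-reflexive (+-comm 6 φ₃)) (run-settle det (subst (λ j → s < height j) (sym j≡) s<j) (trans F≡′ F≡))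
      detached : ∀ {σ₁ φ₁} → (∃[ φ₂ ] (φ₁ ≡ φ₂ + 7 × Detached G s σ₁ φ₂ × s < height (var σ₁ Var.j))) ×
          var σ₁ Var.F ≡ var σ Var.F →
        Run ((size ⟦ ! Var.F ⟧← size ⟦ ! Var.F ⟧ ⊕ lit 1ℤ) ︔ settle) σ₁ φ₁ Searching
      detached {σ₁} ((φ₂ , refl , det , s<j) , F≡) = seq (weaken (≤-reflexive (sym (+-suc φ₂ 6))) (consequence
        (resized σ₁ (trans F≡ g≡) s<j) (keep Var.j refl (keep Var.F refl (frame 6 (run-resize det (trans F≡ g≡)))))))

  -- As `v` itself is unnumbered, the number of unnumbered vertices is positive. That number is
  -- exactly i - 1, the value given to `v`, so `v` drops out of all sums over unnumbered vertices.
  renumber : ∀ {i j k EL B C P S A Rt v z} → SearchCells i j k EL B C P S A Rt →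
    v < m → A at v ≡ 0ℤ → z ≡ + v →
    let A′ = A [ z ∣ 0ℤ ↦ i -ℤ 1ℤ ] in
    SearchCells (i -ℤ 1ℤ) j k EL B C P S A′ Rt × unnumberedWeight A′ + suc (slen v) ≡ unnumberedWeight A
  renumber {i} {j} {k} {EL} {B} {C} {P} {S} {A} {Rt} {v} cells v<m Av refl =
    record
      { queue     = queue cells
      ; numbering = trans i≡ (cong (λ u → + u) (sym (trans (+-comm 1 _) count)))
      ; visits    = visits cells
      } ,
    removed (λ v → suc (slen v))
    where
    A′ = A [ + v ∣ 0ℤ ↦ i -ℤ 1ℤ ]
    i≡ : i -ℤ 1ℤ ≡ + unnumbered A
    i≡ = cong (_-ℤ 1ℤ) (numbering cells)
    positive : ∀ {u w} → 0 < u → ifZero (+ u) w ≡ 0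
    positive {suc u} _ = refl
    unnumbered>0 : 0 < unnumbered A
    unnumbered>0 = subst (_≤ unnumbered A) (cong (λ z → ifZero z 1) Av) (∑-term m (λ x → ifZero (A at x) 1) v<m)
    A′v≡0 : ∀ w → ifZero (A′ at v) w ≡ 0
    A′v≡0 w = trans (cong (λ z → ifZero z w) (trans (at-hit A v _) i≡)) (positive unnumbered>0)
    -- Used for two weights: constantly 1 for the count behind i, and `suc (slen v)` for the
    -- credits.
    removed : ∀ w → (∑[ x < m ] ifZero (A′ at x) (w x)) + w v ≡ (∑[ x < m ] ifZero (A at x) (w x))
    removed w = begin
      (∑[ x < m ] ifZero (A′ at x) (w x)) + w v
        ≡⟨ cong (λ z → (∑[ x < m ] ifZero (A′ at x) (w x)) + ifZero z (w v)) Av ⟨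
      (∑[ x < m ] ifZero (A′ at x) (w x)) + ifZero (A at v) (w v)
        ≡⟨ ∑-update m v<m (λ x _ x≢v → cong (λ z → ifZero z (w x)) (at-row A v _ (x≢v ∘ sym))) ⟩
      (∑[ x < m ] ifZero (A at x) (w x)) + ifZero (A′ at v) (w v)
        ≡⟨ cong (_+_ (∑[ x < m ] ifZero (A at x) (w x))) (A′v≡0 (w v)) ⟩
      (∑[ x < m ] ifZero (A at x) (w x)) + 0
        ≡⟨ +-identityʳ _ ⟩
      (∑[ x < m ] ifZero (A at x) (w x)) ∎
      where open ≡-Reasoning
    count : unnumbered A′ + 1 ≡ unnumbered A
    count = removed (λ _ → 1)

  -- Scanning a set, a vertex and an edge

  scanSet : Com
  scanSet = for Var.q from lit 0ℤ below setLen ⟦ ! Var.v ⟧ do[ (Var.F ≔ sets ⟦ ! Var.v ∣ ! Var.q ⟧) ︔ advance ]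

  -- Origin of the 16 in `potential`: one credit reads F, ten go to `advance`, three are to spare,
  -- and the loop adds two.
  run-scanSet : ∀ {v σ φ} → v < m → Searching σ φ → var σ Var.v ≡ + v →
    Run scanSet σ (2 + (slen v * 16 + φ)) Searching
  run-scanSet {v} {σ} {φ} v<m search@(input , _) v≡ =
    consequence proj₁ (uniformLoop 0 (slen v) 14 I refl refl (λ _ → refl)
      (λ q q<v q≡ (search , v≡) → body q q<v q≡ search v≡)
      (trans (cong (λ z → trunc (tab σ setLen z 0ℤ)) v≡) (cong trunc (setLen≡ input v<m)))
      (search , v≡))
    where
    I : ℕ → Assertion
    I _ σ φ = Searching σ φ × var σ Var.v ≡ + v
    body : ∀ q {σ φ} → q < slen v → var σ Var.q ≡ + q → Searching σ φ → var σ Var.v ≡ + v →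
      Run ((Var.F ≔ sets ⟦ ! Var.v ∣ ! Var.q ⟧) ︔ advance) σ (14 + φ) (λ σ′ φ′ → I (suc q) (setVar Var.q (+ suc q) σ′) φ′)
    body q {σ} {φ} q<v q≡ search@(input , _) v≡ with G , G<n , ST ← sets∈ input v<m q<v =
      seq (straight (weaken (m≤n+m (10 + φ) 3) (consequence (λ (search , eq) → search , trans eq v≡) (keep Var.v refl
        (run-advance {σ = setVar Var.F (tab σ sets (var σ Var.v) (var σ Var.q)) σ} search G<n
          (trans (cong₂ (tab σ sets) v≡ q≡) ST))))))

  scanVertex : Com
  scanVertex = when α ⟦ ! Var.v ⟧ =̇ lit 0ℤ then (
    (Var.i ≔ ! Var.i ⊖ lit 1ℤ) ︔
    (α ⟦ ! Var.v ⟧← ! Var.i) ︔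
    (βⱽ ⟦ ! Var.v ⟧← ! Var.k) ︔
    scanSet)

  run-scanVertex : ∀ {v σ φ} → v < m → Searching σ φ → var σ Var.v ≡ + v →
    Run scanVertex σ (1 + φ) Searching
  run-scanVertex {v} {σ} {φ} v<m search@(input , cells , credit) v≡ = branch new (λ _ → done search)
    where
    A = tab σ α
    A′ = A [ var σ Var.v ∣ 0ℤ ↦ var σ Var.i -ℤ 1ℤ ]
    ρ = potential (var σ Var.j) (tab σ size) A′
    new : isYes (A (var σ Var.v) 0ℤ ℤ.≟ 0ℤ) ≡ true → Run _ σ φ Searching
    new h with cells′ , weight ← renumber cells v<m (trans (cong (λ z → A z 0ℤ) (sym v≡)) (≟-true h)) v≡ =
      weaken (≤-trans enough credit) (seq (straight (seq (straight (seq (straight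
        (run-scanSet {φ = ρ} v<m (input , cells′ , ≤-refl) v≡)))))))
      where
      -- Five credits for the three assignments and the overhead of the loop. The vertex releases 16
      -- to cover them and 16 more for each of its entries.
      enough : 5 + (slen v * 16 + ρ) ≤ potential (var σ Var.j) (tab σ size) A
      enough = begin
        5 + (slen v * 16 + ρ)
          ≤⟨ +-monoˡ-≤ (slen v * 16 + ρ) (≤ᵇ⇒≤ 5 16 tt) ⟩
        16 + (slen v * 16 + ρ)
          ≡⟨ lemma (slen v) (16 * liveWeight (tab σ size)) (unnumberedWeight A′) (2 * height (var σ Var.j)) ⟩
        16 * liveWeight (tab σ size) + 16 * (unnumberedWeight A′ + suc (slen v)) + 2 * height (var σ Var.j)
          ≡⟨ cong (λ w → 16 * liveWeight (tab σ size) + 16 * w + 2 * height (var σ Var.j)) weight ⟩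
        potential (var σ Var.j) (tab σ size) A ∎
        where
        open ≤-Reasoning
        lemma : ∀ s l w h → 16 + (s * 16 + (l + 16 * w + h)) ≡ l + 16 * (w + suc s) + h
        lemma = solve-∀

  scanEdge : Com
  scanEdge = for Var.p from lit 0ℤ below edgeLen ⟦ ! Var.E ⟧ do[ (Var.v ≔ edges ⟦ ! Var.E ∣ ! Var.p ⟧) ︔ scanVertex ]

  run-scanEdge : ∀ {G σ φ} → G < n → Searching σ φ → var σ Var.E ≡ + G →
    Run scanEdge σ (2 + (elen G * 4 + φ)) Searching
  run-scanEdge {G} {σ} {φ} G<n search@(input , _) E≡ =
    consequence proj₁ (uniformLoop 0 (elen G) 2 I refl refl (λ _ → refl)
      (λ p p<e p≡ (search , E≡) → body p p<e p≡ search E≡)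
      (trans (cong (λ z → trunc (tab σ edgeLen z 0ℤ)) E≡) (cong trunc (edgeLen≡ input G<n)))
      (search , E≡))
    where
    I : ℕ → Assertion
    I _ σ φ = Searching σ φ × var σ Var.E ≡ + G
    body : ∀ p {σ φ} → p < elen G → var σ Var.p ≡ + p → Searching σ φ → var σ Var.E ≡ + G →
      Run ((Var.v ≔ edges ⟦ ! Var.E ∣ ! Var.p ⟧) ︔ scanVertex) σ (2 + φ) (λ σ′ φ′ → I (suc p) (setVar Var.p (+ suc p) σ′) φ′)
    body p {σ} {φ} p<e p≡ search@(input , _) E≡ with v , v<m , ET ← edges∈ input G<n p<e =
      seq (straight (consequence (λ (search , eq) → search , trans eq E≡) (keep Var.E refl
        (run-scanVertex {σ = setVar Var.v (tab σ edges (var σ Var.E) (var σ Var.p)) σ} v<m search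
          (trans (cong₂ (tab σ edges) E≡ p≡) ET)))))

  -- An edge releases its credits only when its size becomes -1. Until then the two credits spent on
  -- choosing and deleting it are carried as the debt `d`.
  run-detach-E : ∀ {G s σ φ d} → Input σ → SearchState σ → creditNeeded σ ≤ d + φ →
    G < n → var σ Var.E ≡ + G → tab σ size at G ≡ + s → var σ Var.j ≡ + s →
    Run (delete Var.E from ! Var.j) σ (suc φ) (λ σ′ φ′ → Input σ′ × DetachedState G s σ′ × creditNeeded σ′ ≤ d + φ′)
  run-detach-E input cells credit G<n g≡ SG j≡ = straight (input , detach cells G<n SG g≡ j≡ , credit)

  -- Lowering j and the main loop of the search

  Ready : Store → Set
  Ready σ = ∀ {J} → var σ Var.j ≡ + J → ∃[ c ] tab σ card at J ≡ + suc c

  height-pred : ∀ J → height (+ J -ℤ 1ℤ) ≡ J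
  height-pred zero    = refl
  height-pred (suc J) = refl

  lower : Com
  lower = while (lit 0ℤ ≤̇ ! Var.j and card ⟦ ! Var.j ⟧ =̇ lit 0ℤ) (Var.j ≔ ! Var.j ⊖ lit 1ℤ)

  run-lower : ∀ {σ φ} → Searching σ φ → Run lower σ (suc φ) (λ σ′ φ′ → Searching σ′ φ′ × Ready σ′)
  run-lower search = consequence (λ { {σ} ((input , cells , credit) , h) →
      (input , cells , credit) , ready (queue cells) h }) (loop Searching (λ { {σ} h search → step σ h search }) search)
    where
    ready : ∀ {j B C P S} → Queue m n j B C P S → (0ℤ ℤ.≤ᵇ j) ∧ isYes (C j 0ℤ ℤ.≟ 0ℤ) ≡ false →
      ∀ {J} → j ≡ + J → ∃[ c ] C at J ≡ + suc c
    ready {C = C} queue h {J} refl with counted (buckets queue) (height≤ queue)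
    ... | suc c , CJ = c , CJ
    ... | zero  , CJ = contradiction CJ (≟-false h)

    lowered : ∀ {i j k EL B C P S A Rt J} → SearchCells i j k EL B C P S A Rt → j ≡ + J → C at J ≡ 0ℤ →
      SearchCells i (j -ℤ 1ℤ) k EL B C P S A Rt
    lowered {S = S} {J = J} cells refl CJ = record
      { queue = record
        { buckets = buckets (queue cells)
        ; height≤ = subst (_≤ m) (sym (height-pred J)) (<⇒≤ (height≤ (queue cells)))
        ; sizes<  = λ G<n SG → subst (_ <_) (sym (height-pred J)) (below G<n SG)
        }
      ; numbering = numbering cells
      ; visits    = visits cells
      }
      where
      -- A live edge of size J would be located in bucket J, which is empty.
      below : ∀ {G s} → G < n → S at G ≡ + s → s < J
      below G<n SG = ≤∧≢⇒< (≤-pred (sizes< (queue cells) G<n SG)) λ { refl →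
        case located (buckets (queue cells)) G<n SG of λ { (_ , c , _ , Cs , p<c , _) →
          case subst (_ <_) (+-inj Cs CJ) p<c of λ () } }

    step : ∀ σ {φ} → (0ℤ ℤ.≤ᵇ var σ Var.j) ∧ isYes (tab σ card (var σ Var.j) 0ℤ ℤ.≟ 0ℤ) ≡ true → Searching σ φ →
      Run (Var.j ≔ ! Var.j ⊖ lit 1ℤ) σ φ (λ σ′ φ′ → ∃[ ψ ] (suc ψ ≤ φ′ × Searching σ′ ψ))
    step σ {φ} h (input , cells , credit) with J , j≡ ← ≤-true (var σ Var.j) (∧-conicalˡ _ _ h) =
      weaken (≤-trans (≤-reflexive (sym saved)) credit) (straight (ρ , ≤-refl , input ,
        lowered cells j≡ (trans (cong (λ j → tab σ card j 0ℤ) (sym j≡))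
          (≟-true (∧-conicalʳ (0ℤ ℤ.≤ᵇ var σ Var.j) _ h))) , ≤-refl))
      where
      ρ = potential (var σ Var.j -ℤ 1ℤ) (tab σ size) (tab σ α)
      -- The two credits of the level given up pay the assignment and the next test of the loop.
      saved : creditNeeded σ ≡ 2 + ρ
      saved rewrite j≡ | height-pred J = lemma (16 * liveWeight (tab σ size) + 16 * unnumberedWeight (tab σ α)) J
        where
        lemma : ∀ a h → a + 2 * suc h ≡ 2 + (a + 2 * h)
        lemma = solve-∀

  commit : Com
  commit =
    (Var.k ≔ ! Var.k ⊕ lit 1ℤ) ︔
    (βᴱ ⟦ ! Var.E ⟧← ! Var.k) ︔
    (R ⟦ ! Var.k ⟧← ! Var.E) ︔
    (size ⟦ ! Var.E ⟧← lit -1ℤ) ︔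
    scanEdge ︔
    lower

  run-commit : ∀ {G s σ φ} → Input σ → DetachedState G s σ → creditNeeded σ ≤ 2 + φ → var σ Var.E ≡ + G →
    Run commit σ φ (λ σ′ φ′ → ∃[ ψ ] (suc ψ ≤ φ′ × Searching σ′ ψ × Ready σ′))
  run-commit {G} {s} {σ} {φ} input cells credit E≡ =
    weaken (+-cancelˡ-≤ 2 _ _ (≤-trans enough credit)) (seq (straight (seq (straight (seq (straight (seq (straight
      (seq (consequence scanned (frame 2 (run-scanEdge {φ = ρ} (G<n cells) (input , retired , ≤-refl) E≡))))))))))))
    where
    S = tab σ size
    S′ = S [ var σ Var.E ∣ 0ℤ ↦ -1ℤ ]
    ρ = potential (var σ Var.j) S′ (tab σ α)
    S′G : ∀ s → S′ at G ≢ + s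
    S′G s eq = case trans (sym (trans (cong (λ z → S′ z 0ℤ) (sym E≡)) (write-hit S (var σ Var.E) 0ℤ -1ℤ))) eq of λ ()
    S′≡S : ∀ {H} → H ≢ G → S′ at H ≡ S at H
    S′≡S H≢G = write-row S 0ℤ -1ℤ 0ℤ λ eq → H≢G (+-inj eq E≡)
    retired = retire cells E≡ (visit {EL = tab σ edgeLen} {tab σ R} {S} {S′}
      (DetachedCells.visits cells) (G<n cells) (edgeLen≡ input (G<n cells)) (size≡ cells) S′G S′≡S E≡)
    scanned : ∀ {σ₁ φ₁} → ∃[ φ₂ ] (φ₁ ≡ φ₂ + 2 × Searching σ₁ φ₂) →
      Run lower σ₁ φ₁ (λ σ′ φ′ → ∃[ ψ ] (suc ψ ≤ φ′ × Searching σ′ ψ × Ready σ′))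
    scanned (φ₂ , refl , search) = weaken (≤-reflexive (sym (+-suc φ₂ 1)))
      (consequence (λ { (φ₃ , refl , search , ready) → φ₃ , ≤-reflexive (+-comm 1 φ₃) , search , ready })
        (frame 1 (run-lower search)))
    -- The debt of 2, four assignments, the scan of the edge, and two credits for the first test of
    -- `lower` and the next test of the search loop.
    enough : 2 + (4 + (2 + (elen G * 4 + ρ) + 2)) ≤ creditNeeded σ
    enough = begin
      2 + (4 + (2 + (elen G * 4 + ρ) + 2))
        ≡⟨ lemma₁ (elen G) ρ ⟩
      10 + 4 * elen G + ρ
        ≤⟨ +-monoˡ-≤ ρ (+-mono-≤ (≤ᵇ⇒≤ 10 16 tt) (*-monoˡ-≤ (elen G) (≤ᵇ⇒≤ 4 16 tt))) ⟩
      16 + 16 * elen G + ρ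
        ≡⟨ lemma₂ (elen G) (liveWeight S′) (16 * unnumberedWeight (tab σ α)) (2 * height (var σ Var.j)) ⟩
      16 * (liveWeight S′ + suc (elen G)) + 16 * unnumberedWeight (tab σ α) + 2 * height (var σ Var.j)
        ≡⟨ cong (λ l → 16 * l + 16 * unnumberedWeight (tab σ α) + 2 * height (var σ Var.j))
             (liveWeight-retire S S′ (G<n cells) (size≡ cells) S′G S′≡S) ⟩
      creditNeeded σ ∎
      where
      open ≤-Reasoning
      lemma₁ : ∀ e r → 2 + (4 + (2 + (e * 4 + r) + 2)) ≡ 10 + 4 * e + r
      lemma₁ = solve-∀
      lemma₂ : ∀ e l u h → 16 + 16 * e + (16 * l + u + h) ≡ 16 * (l + suc e) + u + h
      lemma₂ = solve-∀

  visitEdge : Com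
  visitEdge = choose Var.E from ! Var.j ︔ delete Var.E from ! Var.j ︔ commit

  run-visitEdge : ∀ {σ φ J} → Searching σ φ → Ready σ → var σ Var.j ≡ + J →
    Run visitEdge σ φ (λ σ′ φ′ → ∃[ ψ ] (suc ψ ≤ φ′ × Searching σ′ ψ × Ready σ′))
  run-visitEdge {σ} {φ} {J} (input , cells , credit) ready j≡
    with c , CJ ← ready j≡
    with G , G<n , E≡ , SG ← chosen (tab σ oracle (var σ Var.k) 0ℤ) (queue cells) j≡ CJ =
    weaken (≤-reflexive (m+[n∸m]≡n 2≤φ))
      (seq (straight (seq (consequence (λ ((input , cells , credit) , eq) → run-commit input cells credit (trans eq E≡))
        (keep Var.E refl (run-detach-E {σ = setVar Var.E z σ} {d = 2} input cells
          (≤-trans credit (≤-reflexive (sym (m+[n∸m]≡n 2≤φ)))) G<n E≡ SG j≡))))))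
    where
    z = tab σ bucket (var σ Var.j) (modℤ (tab σ oracle (var σ Var.k) 0ℤ) (tab σ card (var σ Var.j) 0ℤ))
    -- As j ≥ 0, the two credits of its lowest level can be lent; the retired edge pays them back.
    2≤φ : 2 ≤ φ
    2≤φ = ≤-trans (subst (λ j → 2 ≤ 2 * height j) (sym j≡) (*-monoʳ-≤ 2 (s≤s z≤n)))
      (≤-trans (m≤n+m (2 * height (var σ Var.j)) (16 * liveWeight (tab σ size) + 16 * unnumberedWeight (tab σ α))) credit)

  run-search : ∀ {σ φ} → Searching σ φ → Ready σ → Run search σ (suc φ) Searching
  run-search search ready = consequence (λ ((search , _) , _) → search)
    (loop (λ σ φ → Searching σ φ × Ready σ)
      (λ { {σ} h (search , ready) → run-visitEdge search ready (proj₂ (≤-true (var σ Var.j) h)) })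
      (search , ready))

  -- Initial queue

  record Filled (g : ℕ) (B C P S : Cells) : Set where
    field
      card-0   : C at 0 ≡ + g
      card-suc : ∀ {s} → suc s < m → C at suc s ≡ 0ℤ
      stored-0 : ∀ {G} → G < g → B 0ℤ (+ G) ≡ + G × S at G ≡ 0ℤ × P at G ≡ + G
  open Filled

  fill-bucket : ∀ {g B C P S z} → z ≡ + g → Filled g B C P S →
    Filled (suc g) (B [ 0ℤ ∣ C at 0 ↦ z ]) (C [ 0ℤ ∣ 0ℤ ↦ C at 0 +ℤ 1ℤ ]) (P [ z ∣ 0ℤ ↦ C at 0 ]) (S [ z ∣ 0ℤ ↦ 0ℤ ])
  fill-bucket {g} {B} {C} {P} {S} refl filled = record
    { card-0   = trans (at-hit C 0 _) (trans (cong (_+ℤ 1ℤ) (card-0 filled)) (cong +_ (+-comm g 1)))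
    ; card-suc = λ s<m → trans (at-row C 0 (C at 0 +ℤ 1ℤ) λ ()) (card-suc filled s<m)
    ; stored-0 = stored′
    }
    where
    stored′ : ∀ {G} → G < suc g → (B [ 0ℤ ∣ C at 0 ↦ + g ]) 0ℤ (+ G) ≡ + G ×
      (S [ + g ∣ 0ℤ ↦ 0ℤ ]) at G ≡ 0ℤ × (P [ + g ∣ 0ℤ ↦ C at 0 ]) at G ≡ + G
    stored′ {G} G<1+g rewrite card-0 filled with g ≡? G
    ... | yes refl = write-hit B 0ℤ (+ g) (+ g) , at-hit S g 0ℤ , at-hit P g (+ g)
    ... | no g≢G with BG , SG , PG ← stored-0 filled (≤∧≢⇒< (≤-pred G<1+g) (g≢G ∘ sym)) =
      trans (write-column B 0ℤ (+ g) (+ g) 0ℤ (+≢ g≢G)) BG , trans (at-row S g 0ℤ g≢G) SG , trans (at-row P g (+ g) g≢G) PG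

  -- While the loop runs, the sizes of the edges not yet entered are arbitrary memory and could
  -- violate `located`; `Buckets` is therefore established only once all n are written. Edges enter
  -- `set(0)` in order, so each is its own position.
  filled⇒queue : ∀ {B C P S} → 0 < m → Filled n B C P S → Queue m n 0ℤ B C P S
  filled⇒queue {B} {C} {P} {S} 0<m filled = record
    { buckets = record { counted = counted′ ; stored = stored′ ; located = located′ }
    ; height≤ = 0<m
    ; sizes<  = λ G<n SG → subst (_< 1) (+-inj (proj₁ (proj₂ (stored-0 filled G<n))) SG) (s≤s z≤n)
    }
    where
    counted′ : ∀ {s} → s < m → ∃[ c ] C at s ≡ + c
    counted′ {zero}  _   = n , card-0 filled
    counted′ {suc s} s<m = 0 , card-suc filled s<m
    stored′ : ∀ {s c p} → s < m → C at s ≡ + c → p < c →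
      ∃[ G ] (G < n × B (+ s) (+ p) ≡ + G × S at G ≡ + s × P at G ≡ + p)
    stored′ {zero} {p = p} _ Cs p<c with refl ← +-inj (card-0 filled) Cs
      with BG , SG , PG ← stored-0 filled p<c = p , p<c , BG , SG , PG
    stored′ {suc s} s<m Cs p<c with refl ← +-inj (card-suc filled s<m) Cs with () ← p<c
    located′ : ∀ {G s} → G < n → S at G ≡ + s → s < m ×
      ∃[ c ] ∃[ p ] (C at s ≡ + c × p < c × P at G ≡ + p × B (+ s) (+ p) ≡ + G)
    located′ {G} G<n SG with BG , SG′ , PG ← stored-0 filled G<n with refl ← +-inj SG′ SG =
      0<m , n , G , card-0 filled , G<n , PG , BG

  totalSets : ℕ
  totalSets = ∑[ v < m ] suc (slen v)

  -- An upper bound on the potential after initialisation, the final 2 being that of j = 0.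
  searchCredit : ℕ
  searchCredit = 16 * totalWeight + 16 * totalSets + 2

  Sized : Store → Set
  Sized σ = Input σ × var σ #N ≡ + m

  run-initialise : ∀ {σ} → 0 < m → 0 < n → Input σ →
    Run initialise σ (1 + (2 + (m * 3 + (2 + (m * 3 + (2 + (n * 3 + (3 + searchCredit))))))))
      (λ σ′ φ′ → (Searching σ′ φ′ × Ready σ′) × var σ′ #N ≡ + m)
  run-initialise 0<m 0<n input = seq (straight (seq (consequence cards-done
    (uniformLoop 0 m 1 Cards refl refl (λ _ → refl)
      (λ { q {σ} q<m x≡ (sized , credit , zeros) → straight (sized , credit , fill (tab σ card) x≡ zeros) })
      (cong trunc (#m≡ input)) ((input , #m≡ input) , ≤-refl , λ ())))))
    where
    Cards Alphas Queues : ℕ → Assertion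
    Cards q σ φ = Sized σ × 2 + (m * 3 + (2 + (n * 3 + (3 + searchCredit)))) ≤ φ ×
      (∀ {s} → s < q → tab σ card at s ≡ 0ℤ)
    Alphas q σ φ = Sized σ × 2 + (n * 3 + (3 + searchCredit)) ≤ φ ×
      (∀ {s} → s < m → tab σ card at s ≡ 0ℤ) × (∀ {v} → v < q → tab σ α at v ≡ 0ℤ)
    Queues q σ φ = Sized σ × 3 + searchCredit ≤ φ × (∀ {v} → v < m → tab σ α at v ≡ 0ℤ) ×
      Filled q (tab σ bucket) (tab σ card) (tab σ pos) (tab σ size)

    Result : Assertion
    Result σ φ = (Searching σ φ × Ready σ) × var σ #N ≡ + m

    queues-done : ∀ {σ φ} → Queues n σ φ →
      Run ((Var.i ≔ ! #N ⊕ lit 1ℤ) ︔ (Var.j ≔ lit 0ℤ) ︔ (Var.k ≔ lit 0ℤ)) σ φ Result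
    queues-done {σ} ((input , N≡) , credit , zeros , filled) =
      weaken credit (seq (straight (seq (straight (straight
        (((input , record
          { queue     = filled⇒queue 0<m filled
          ; numbering = trans (cong (_+ℤ 1ℤ) N≡) (cong +_ (trans (+-comm m 1) (cong suc (sym all-unnumbered))))
          ; visits    = 0 , refl , live≤
          } , enough) , ready) , N≡))))))
      where
      S = tab σ size
      A = tab σ α
      live≤ : liveWeight S ≤ totalWeight
      live≤ = ∑-mono n λ G _ → ifNonneg-≤ (S at G) _
      all-unnumbered : unnumbered A ≡ m
      all-unnumbered = trans (∑-cong m λ v v<m → cong (λ z → ifZero z 1) (zeros v<m))
        (trans (∑-const m 1) (*-identityʳ m))
      enough : potential 0ℤ S A ≤ searchCredit
      enough = +-monoˡ-≤ 2 (+-mono-≤ (*-monoʳ-≤ 16 live≤) (*-monoʳ-≤ 16 (∑-mono m λ v _ → ifZero-≤ (A at v) _)))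
      ready : ∀ {J} → 0ℤ ≡ + J → ∃[ c ] tab σ card at J ≡ + suc c
      ready refl = nonzero 0<n (card-0 filled)

    alphas-done : ∀ {σ φ} → Alphas m σ φ →
      Run ((for Var.E from lit 0ℤ below ! #n do[
              (size ⟦ ! Var.E ⟧← lit 0ℤ) ︔ (γ ⟦ ! Var.E ⟧← lit 0ℤ) ︔ add Var.E to lit 0ℤ ]) ︔
           (Var.i ≔ ! #N ⊕ lit 1ℤ) ︔ (Var.j ≔ lit 0ℤ) ︔ (Var.k ≔ lit 0ℤ)) σ φ Result
    alphas-done {σ} (sized@(input , _) , credit , empty , zeros) =
      weaken credit (seq (consequence queues-done (uniformLoop 0 n 1 Queues refl refl (λ _ → refl)
        (λ { q {σ} q<n E≡ (sized , credit , zeros , filled) → straight (sized , credit , zeros , fill-bucket E≡ filled) })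
        (cong trunc (#n≡ input))
        (sized , ≤-refl , zeros , record { card-0 = empty 0<m ; card-suc = empty ; stored-0 = λ () }))))

    cards-done : ∀ {σ φ} → Cards m σ φ →
      Run ((for Var.v from lit 0ℤ below ! #N do[ α ⟦ ! Var.v ⟧← lit 0ℤ ]) ︔
           (for Var.E from lit 0ℤ below ! #n do[
              (size ⟦ ! Var.E ⟧← lit 0ℤ) ︔ (γ ⟦ ! Var.E ⟧← lit 0ℤ) ︔ add Var.E to lit 0ℤ ]) ︔
           (Var.i ≔ ! #N ⊕ lit 1ℤ) ︔ (Var.j ≔ lit 0ℤ) ︔ (Var.k ≔ lit 0ℤ)) σ φ Result
    cards-done (sized@(_ , N≡) , credit , empty) =
      weaken credit (seq (consequence alphas-done (uniformLoop 0 m 1 Alphas refl refl (λ _ → refl)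
        (λ { q {σ} q<m v≡ (sized , credit , empty , zeros) → straight (sized , credit , empty , fill (tab σ α) v≡ zeros) })
        (cong trunc N≡) (sized , ≤-refl , empty , λ ()))))

  -- Grouping by γ and the test

  childWeight : Cells → Cells → Cells → ℕ → ℕ
  childWeight EL CL CH x = ∑[ p < trunc (CL at x) ] edgeWeight EL (CH (+ x) (+ p))

  -- Holds for arbitrary contents of CL outside the rows 1,…,K, so nothing need be known about γ.
  childWeight-append : ∀ {K N g} EL CL CH z → (∑[ x < K ] childWeight EL CL CH (suc x)) ≤ N →
    (∑[ x < K ] childWeight EL (CL [ z ∣ 0ℤ ↦ CL z 0ℤ +ℤ 1ℤ ]) (CH [ z ∣ CL z 0ℤ ↦ g ]) (suc x)) ≤ N + edgeWeight EL g
  childWeight-append {K} {N} {g} EL CL CH z h = listed z refl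
    where
    CL′ = CL [ z ∣ 0ℤ ↦ CL z 0ℤ +ℤ 1ℤ ]
    CH′ = CH [ z ∣ CL z 0ℤ ↦ g ]
    old = childWeight EL CL CH
    new = childWeight EL CL′ CH′

    elsewhere : ∀ {x} → z ≢ + x → new x ≡ old x
    elsewhere {x} z≢x rewrite write-row CL {z} {+ x} 0ℤ (CL z 0ℤ +ℤ 1ℤ) 0ℤ z≢x =
      ∑-cong (trunc (CL at x)) λ p _ → cong (edgeWeight EL) (write-row CH _ g (+ p) z≢x)

    grown : ∀ x c → (∑[ p < trunc (c +ℤ 1ℤ) ] edgeWeight EL ((CH [ + x ∣ c ↦ g ]) (+ x) (+ p))) ≤
      (∑[ p < trunc c ] edgeWeight EL (CH (+ x) (+ p))) + edgeWeight EL g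
    grown x -[1+ 0 ]     = z≤n
    grown x -[1+ suc _ ] = z≤n
    grown x (+ c) rewrite +-comm c 1 = ≤-reflexive (trans (∑-suc c _)
      (cong₂ _+_ (∑-cong c λ p p<c → cong (edgeWeight EL) (write-column CH (+ x) (+ c) g (+ x) (+≢ (<⇒≢ p<c ∘ sym))))
                 (cong (edgeWeight EL) (write-hit CH (+ x) (+ c) g))))

    here : ∀ {x} → z ≡ + x → new x ≤ old x + edgeWeight EL g
    here {x} refl = ≤-trans
      (≤-reflexive (cong (λ c → ∑[ p < trunc c ] edgeWeight EL (CH′ (+ x) (+ p))) (write-hit CL (+ x) 0ℤ _)))
      (grown x (CL at x))

    unlisted : (∀ {x} → x < K → z ≢ + suc x) → (∑[ x < K ] new (suc x)) ≤ N + edgeWeight EL g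
    unlisted z≢ = ≤-trans (≤-reflexive (∑-cong K λ x x<K → elsewhere (z≢ x<K))) (≤-trans h (m≤m+n N _))

    listed : ∀ y → z ≡ y → (∑[ x < K ] new (suc x)) ≤ N + edgeWeight EL g
    listed -[1+ _ ]  refl = unlisted λ _ ()
    listed (+ 0)     refl = unlisted λ _ ()
    listed (+ suc x) refl with x <? K
    ... | no x≮K  = unlisted λ { y<K eq → x≮K (subst (_< K) (sym (suc-injective (ℤ.+-injective eq))) y<K) }
    ... | yes x<K = +-cancelʳ-≤ (old (suc x)) _ _ (begin
      (∑[ y < K ] new (suc y)) + old (suc x)
        ≡⟨ ∑-update K x<K (λ y _ y≢x → elsewhere (+≢ (y≢x ∘ sym ∘ suc-injective))) ⟩
      (∑[ y < K ] old (suc y)) + new (suc x)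
        ≤⟨ +-mono-≤ h (here refl) ⟩
      N + (old (suc x) + edgeWeight EL g)
        ≡⟨ trans (cong (_+_ N) (+-comm (old (suc x)) _)) (sym (+-assoc N _ _)) ⟩
      N + edgeWeight EL g + old (suc x) ∎)
      where open ≤-Reasoning

  -- Tables that the test only reads are frozen as parameters, which makes the sums bounding its
  -- loops fixed expressions independent of the current store.
  module Testing (K : ℕ) (EL Rt : Cells) (EL≡ : ∀ {G} → G < n → EL at G ≡ + elen G)
    (visited : (∑[ x < K ] edgeWeight EL (Rt at suc x)) ≤ totalWeight) where

    Visited : Store → Set
    Visited σ = var σ Var.k ≡ + K × var σ #n ≡ + n × tab σ edgeLen ≡ EL × tab σ R ≡ Rt

    k+1≡ : ∀ {k} → k ≡ + K → trunc (k +ℤ 1ℤ) ≡ 1 + K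
    k+1≡ refl = +-comm K 1

    Grouped : Assertion
    Grouped σ φ = Visited σ × (∑[ x < K ] childWeight EL (tab σ childLen) (tab σ child) (suc x)) ≤ totalWeight

    run-groupByγ : ∀ {σ} ψ → Visited σ →
      Run groupByγ σ (2 + (K * 3 + (2 + (n * 4 + ψ)))) (λ σ′ φ′ → Grouped σ′ φ′ × ψ ≤ φ′)
    run-groupByγ ψ vis@(k≡ , _) = seq (consequence lengths-done (uniformLoop 1 K 1 Lengths refl refl (λ _ → refl)
      (λ { q {σ} q<K x≡ (vis , credit , zeros) → straight (vis , credit , fill-suc (tab σ childLen) x≡ zeros) })
      (k+1≡ k≡) (vis , ≤-refl , λ ())))
      where
      Lengths Children : ℕ → Assertion
      Lengths q σ φ = Visited σ × 2 + (n * 4 + ψ) ≤ φ × (∀ {x} → x < q → tab σ childLen at suc x ≡ 0ℤ)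
      -- Each of the first q edges has been appended at most once, whatever row it went to.
      Children q σ φ = Visited σ × ψ ≤ φ ×
        (∑[ x < K ] childWeight EL (tab σ childLen) (tab σ child) (suc x)) ≤ (∑[ G < q ] suc (elen G))

      fill-suc : ∀ f {r z c} → z ≡ + suc r → (∀ {x} → x < r → f at suc x ≡ c) →
        ∀ {x} → x < suc r → (f [ z ∣ 0ℤ ↦ c ]) at suc x ≡ c
      fill-suc f {r} refl h {x} x<1+r with r ≡? x
      ... | yes refl = at-hit f (suc r) _
      ... | no r≢x   = trans (at-row f (suc r) _ (r≢x ∘ suc-injective)) (h (≤∧≢⇒< (≤-pred x<1+r) (r≢x ∘ sym)))

      appended : ∀ q {σ φ} → q < n → var σ Var.E ≡ + q → Children q σ φ →
        Run (when lit 0ℤ <̇ γ ⟦ ! Var.E ⟧ then (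
          (Var.x ≔ γ ⟦ ! Var.E ⟧) ︔
          (child ⟦ ! Var.x ∣ childLen ⟦ ! Var.x ⟧ ⟧← ! Var.E) ︔
          (childLen ⟦ ! Var.x ⟧← childLen ⟦ ! Var.x ⟧ ⊕ lit 1ℤ))) σ (2 + φ)
          (λ σ′ φ′ → Children (suc q) (setVar Var.E (+ suc q) σ′) φ′)
      appended q {σ} {φ} q<n E≡ (vis , credit , weight) = branch
        (λ _ → straight (vis , credit , ≤-trans
          (childWeight-append {K} EL (tab σ childLen) (tab σ child) (tab σ γ (var σ Var.E) 0ℤ) weight)
          (≤-reflexive bound)))
        (λ _ → done (vis , ≤-trans credit (n≤1+n φ) ,
          ≤-trans weight (≤-trans (m≤m+n _ (suc (elen q))) (≤-reflexive (sym (∑-suc q _))))))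
        where
        bound : (∑[ G < q ] suc (elen G)) + edgeWeight EL (var σ Var.E) ≡ (∑[ G < suc q ] suc (elen G))
        bound = trans (cong (λ w → (∑[ G < q ] suc (elen G)) + suc w)
            (trans (cong (λ z → trunc (EL z 0ℤ)) E≡) (cong trunc (EL≡ q<n))))
          (sym (∑-suc q (λ G → suc (elen G))))

      lengths-done : ∀ {σ φ} → Lengths K σ φ → Run _ σ φ (λ σ′ φ′ → Grouped σ′ φ′ × ψ ≤ φ′)
      lengths-done {σ} (vis@(_ , n≡ , _) , credit , zeros) = weaken credit (consequence
        (λ (vis , credit , weight) → (vis , weight) , credit)
        (uniformLoop 0 n 2 Children refl refl (λ _ → refl) (λ q → appended q) (cong trunc n≡)
          (vis , ≤-refl , ≤-reflexive (trans
            (∑-cong K λ x x<K → cong (λ c → ∑[ p < trunc c ] edgeWeight EL (tab σ child (+ suc x) (+ p))) (zeros x<K))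
                                              (trans (∑-const K 0) (*-zeroʳ K))))))

    module Rows (CL CH : Cells)
      (grouped : (∑[ x < K ] childWeight EL CL CH (suc x)) ≤ totalWeight) where

      -- The reserved credit pays the `return` after all rows; an early `return` is paid from the
      -- iteration in which it occurs.
      Row : ℕ → Assertion
      Row x σ φ = Visited σ × tab σ childLen ≡ CL × tab σ child ≡ CH × var σ Var.i ≡ + x × 1 ≤ φ

      checkChild : Com
      checkChild =
        (Var.E ≔ child ⟦ ! Var.i ∣ ! Var.p ⟧) ︔
        for Var.q from lit 0ℤ below edgeLen ⟦ ! Var.E ⟧ do[
          (Var.v ≔ edges ⟦ ! Var.E ∣ ! Var.q ⟧) ︔
          (when βⱽ ⟦ ! Var.v ⟧ <̇ ! Var.i and index ⟦ ! Var.v ⟧ <̇ ! Var.i then return (lit 0ℤ)) ]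

      run-checkChild : ∀ {x p σ φ} → Row x σ φ → var σ Var.p ≡ + p →
        Run checkChild σ (3 + (trunc (EL (CH (+ x) (+ p)) 0ℤ) * 5 + φ)) (Row x)
      run-checkChild {x} {p} {σ} row@((_ , _ , EL≡ , _) , _ , CH≡ , i≡ , _) p≡ = seq (straight
        (uniformLoop 0 (trunc (EL (CH (+ x) (+ p)) 0ℤ)) 3 (λ _ → Row x) refl refl (λ _ → refl)
          (λ { q {φ = φ} _ _ (vis , cl , ch , i≡ , credit) →
            seq (straight (branch (λ _ → leave) (λ _ → done (vis , cl , ch , i≡ , ≤-trans credit (n≤1+n φ))))) })
          (cong trunc (trans (cong (λ f → f (tab σ child (var σ Var.i) (var σ Var.p)) 0ℤ) EL≡)
            (cong (λ E → EL E 0ℤ) (trans (cong (λ f → f (var σ Var.i) (var σ Var.p)) CH≡) (cong₂ CH i≡ p≡)))))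
          row))

      checkRow : Com
      checkRow =
        (Var.F ≔ R ⟦ ! Var.i ⟧) ︔
        (for Var.p from lit 0ℤ below edgeLen ⟦ ! Var.F ⟧ do[
          index ⟦ edges ⟦ ! Var.F ∣ ! Var.p ⟧ ⟧← ! Var.i ]) ︔
        (for Var.p from lit 0ℤ below childLen ⟦ ! Var.i ⟧ do[ checkChild ])

      rowCredit : ℕ → ℕ
      rowCredit x = 1 + (2 + (trunc (EL (Rt at x) 0ℤ) * 3 + (2 +
        (∑[ p < trunc (CL at x) ] 2 + (3 + trunc (EL (CH (+ x) (+ p)) 0ℤ) * 5)))))

      run-checkRow : ∀ {x σ φ} → Row x σ φ → Run checkRow σ (rowCredit x + φ) (Row x)
      run-checkRow {x} {σ} {φ} ((k≡ , n≡ , EL≡ , R≡) , cl , ch , i≡ , 1≤φ) =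
        weaken (≤-reflexive (reassoc (trunc (EL (Rt at x) 0ℤ) * 3) children φ)) (seq (straight (seq (consequence
          (λ { {σ} ((vis , cl , ch , i≡ , _) , credit) → weaken credit
            (forLoop 0 (trunc (CL at x)) (λ p → 3 + trunc (EL (CH (+ x) (+ p)) 0ℤ) * 5) (λ _ → Row x) refl refl (λ _ → refl)
              (λ { p {φ = φ} _ p≡ row → run-checkChild row p≡ })
              (cong trunc (trans (cong (λ f → f (var σ Var.i) 0ℤ) cl) (cong (λ i → CL i 0ℤ) i≡)))
              (vis , cl , ch , i≡ , 1≤φ)) })
          (uniformLoop 0 (trunc (EL (Rt at x) 0ℤ)) 1 (λ _ σ φ′ → Row x σ φ′ × 2 + (children + φ) ≤ φ′) refl refl (λ _ → refl)
            (λ { q _ _ (row , credit) → straight (row , credit) })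
            (cong trunc (trans (cong (λ f → f (tab σ R (var σ Var.i) 0ℤ) 0ℤ) EL≡)
              (cong (λ F → EL F 0ℤ) (trans (cong (λ f → f (var σ Var.i) 0ℤ) R≡) (cong (λ i → Rt i 0ℤ) i≡)))))
            ((( k≡ , n≡ , EL≡ , R≡) , cl , ch , i≡ , s≤s z≤n) , ≤-refl))))))
        where
        children = ∑[ p < trunc (CL at x) ] 2 + (3 + trunc (EL (CH (+ x) (+ p)) 0ℤ) * 5)
        reassoc : ∀ a b c → 1 + (2 + (a + (2 + (b + c)))) ≡ 1 + (2 + (a + (2 + b))) + c
        reassoc = solve-∀

      -- Row x takes 7 + 3|R(x)| credits of its own and 5(1 + |E|) for each child E. The former are
      -- charged to the visited edges at 7 per unit of weight, the latter to the grouped edges at 5,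
      -- and each family weighs at most `totalWeight`.
      rows≤ : (∑[ x < K ] 2 + rowCredit (suc x)) ≤ 12 * totalWeight
      rows≤ = begin
        (∑[ x < K ] 2 + rowCredit (suc x))
          ≤⟨ ∑-mono K (λ x _ → row≤ x) ⟩
        (∑[ x < K ] 7 * edgeWeight EL (Rt at suc x) + 5 * childWeight EL CL CH (suc x))
          ≡⟨ ∑-distrib-+ K _ _ ⟩
        (∑[ x < K ] 7 * edgeWeight EL (Rt at suc x)) + (∑[ x < K ] 5 * childWeight EL CL CH (suc x))
          ≡⟨ cong₂ _+_ (∑-distrib-* K 7 _) (∑-distrib-* K 5 _) ⟩
        7 * (∑[ x < K ] edgeWeight EL (Rt at suc x)) + 5 * (∑[ x < K ] childWeight EL CL CH (suc x))
          ≤⟨ +-mono-≤ (*-monoʳ-≤ 7 visited) (*-monoʳ-≤ 5 grouped) ⟩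
        7 * totalWeight + 5 * totalWeight
          ≡⟨ *-distribʳ-+ totalWeight 7 5 ⟨
        12 * totalWeight ∎
        where
        open ≤-Reasoning
        lemma : ∀ t s → 2 + (1 + (2 + (t * 3 + (2 + s)))) + 4 * t ≡ 7 * suc t + s
        lemma = solve-∀
        five : ∀ t → 2 + (3 + t * 5) ≡ 5 * suc t
        five = solve-∀
        row≤ : ∀ x → 2 + rowCredit (suc x) ≤ 7 * edgeWeight EL (Rt at suc x) + 5 * childWeight EL CL CH (suc x)
        row≤ x = begin
          2 + rowCredit (suc x)
            ≤⟨ m≤m+n _ (4 * t) ⟩
          2 + rowCredit (suc x) + 4 * t
            ≡⟨ lemma t _ ⟩
          7 * suc t + (∑[ p < trunc (CL at suc x) ] 2 + (3 + trunc (EL (CH (+ suc x) (+ p)) 0ℤ) * 5))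
            ≡⟨ cong (_+_ (7 * suc t)) (trans (∑-cong (trunc (CL at suc x)) λ p _ → five _)
                 (∑-distrib-* (trunc (CL at suc x)) 5 _)) ⟩
          7 * suc t + 5 * childWeight EL CL CH (suc x) ∎
          where t = trunc (EL (Rt at suc x) 0ℤ)

      checkRows : Com
      checkRows = for Var.i from lit 1ℤ below ! Var.k ⊕ lit 1ℤ do[ checkRow ]

      run-checkRows : ∀ {σ} → Visited σ → tab σ childLen ≡ CL → tab σ child ≡ CH →
        Run checkRows σ (2 + (12 * totalWeight + 1)) (λ _ φ → 1 ≤ φ)
      run-checkRows {σ} vis@(k≡ , _) cl ch = weaken (+-monoʳ-≤ 2 (+-monoˡ-≤ 1 rows≤)) (consequence
        (λ (_ , _ , _ , credit) → credit)
        (forLoop 1 K (λ x → rowCredit (suc x)) (λ _ σ φ → Visited σ × tab σ childLen ≡ CL × tab σ child ≡ CH × 1 ≤ φ)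
          refl refl (λ _ → refl)
          (λ { q _ i≡ (vis , cl , ch , credit) → consequence (λ (vis , cl , ch , _ , credit) → vis , cl , ch , credit)
                 (run-checkRow (vis , cl , ch , i≡ , credit)) })
          (k+1≡ k≡) (vis , cl , ch , ≤-refl)))

  testCredit : ℕ
  testCredit = 2 + (m * 3 + (2 + (totalWeight * 3 + (2 + (n * 4 + (2 + (12 * totalWeight + 1)))))))

  run-test : ∀ {σ φ} → Searching σ φ → var σ #N ≡ + m → Run test σ testCredit (λ _ _ → ⊤)
  run-test {σ₀} (input , cells , _) N≡ with K , k≡ , visits≤ ← visits cells =
    weaken (+-monoʳ-≤ 2 (+-monoʳ-≤ (m * 3) (+-monoʳ-≤ 2 (+-monoˡ-≤ rest (*-monoˡ-≤ 3 K≤)))))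
      (seq (consequence indexed (uniformLoop 0 m 1 (λ _ σ φ → Visited σ × 2 + (K * 3 + rest) ≤ φ) refl refl (λ _ → refl)
        (λ { q _ _ vis → straight vis })
        (cong trunc N≡) ((k≡ , #n≡ input , refl , refl) , ≤-refl))))
    where
    rest = 2 + (n * 4 + (2 + (12 * totalWeight + 1)))
    visited : (∑[ x < K ] edgeWeight (tab σ₀ edgeLen) (tab σ₀ R at suc x)) ≤ totalWeight
    visited = ≤-trans (m≤m+n _ _) visits≤
    -- Every visited edge has weight at least 1.
    K≤ : K ≤ totalWeight
    K≤ = ≤-trans (≤-reflexive (sym (trans (∑-const K 1) (*-identityʳ K)))) (≤-trans (∑-mono K λ x _ → s≤s z≤n) visited)
    open Testing K (tab σ₀ edgeLen) (tab σ₀ R) (edgeLen≡ input) visited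
    indexed : ∀ {σ φ} → Visited σ × 2 + (K * 3 + rest) ≤ φ → Run _ σ φ (λ _ _ → ⊤)
    indexed (vis , credit) = weaken credit (seq (consequence
      (λ { {σ} ((vis , grouped) , credit) → weaken credit (seq (consequence
        (λ 1≤φ → weaken 1≤φ leave) (Rows.run-checkRows (tab σ childLen) (tab σ child) grouped vis refl refl))) })
      (run-groupByγ (2 + (12 * totalWeight + 1)) vis)))

  acyclicCredit : ℕ
  acyclicCredit = 22 + 9 * m + 7 * n + 31 * totalWeight + 16 * totalSets

  run-isAcyclic : ∀ {σ} → 0 < m → 0 < n → Input σ → Run isAcyclic σ acyclicCredit (λ _ _ → ⊤)
  run-isAcyclic 0<m 0<n input = weaken (≤-reflexive (linear m n totalWeight totalSets)) (seq (consequence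
    (λ { (φ , refl , (search , ready) , N≡) → weaken (≤-reflexive (sym (+-suc φ testCredit))) (seq (consequence
      (λ { ((φ , refl , search) , N≡′) → weaken (m≤n+m testCredit φ) (run-test search (trans N≡′ N≡)) })
      (keep #N refl (frame testCredit (run-search search ready))))) })
    (frame (1 + testCredit) (run-initialise 0<m 0<n input))))
    where
    linear : ∀ m n W T →
      1 + (2 + (m * 3 + (2 + (m * 3 + (2 + (n * 3 + (3 + (16 * W + 16 * T + 2)))))))) +
      (1 + (2 + (m * 3 + (2 + (W * 3 + (2 + (n * 4 + (2 + (12 * W + 1))))))))) ≡
      22 + 9 * m + 7 * n + 31 * W + 16 * T
    linear = solve-∀

  run-genForest : ∀ {σ} ψ → var σ #n ≡ + n → Run genForest σ (3 + (n * 6 + ψ)) (λ _ φ → ψ ≤ φ)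
  run-genForest ψ n≡ = seq (straight (uniformLoop 0 n 4 (λ _ _ φ → ψ ≤ φ) refl refl (λ _ → refl)
    (λ { q {φ = φ} _ _ credit → branch
      (λ _ → seq (straight (seq (straight (straight credit)))))
      (λ _ → done (≤-trans credit (m≤n+m φ 3))) })
    (cong trunc n≡) ≤-refl))

-- Construction of the dual hypergraph

lookup-injective : ∀ {A : Set} {xs : List A} → Unique xs → ∀ i j → lookup xs i ≡ lookup xs j → i ≡ j
lookup-injective (_   ∷ _) Fin.zero    Fin.zero    eq = refl
lookup-injective (x∉  ∷ _) Fin.zero    (Fin.suc j) eq = contradiction eq (All.lookup x∉ (∈-lookup j))
lookup-injective (x∉  ∷ _) (Fin.suc i) Fin.zero    eq = contradiction (sym eq) (All.lookup x∉ (∈-lookup i))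
lookup-injective (_   ∷ u) (Fin.suc i) (Fin.suc j) eq = cong Fin.suc (lookup-injective u i j eq)

length-concat-tabulate : ∀ {A : Set} m (f : Fin m → List A) →
  length (concat (tabulate f)) ≡ sum (tabulate (length ∘ f))
length-concat-tabulate zero    f = refl
length-concat-tabulate (suc m) f = trans (length-++ (f Fin.zero))
  (cong (_+_ (length (f Fin.zero))) (length-concat-tabulate m (f ∘ Fin.suc)))

∑-tabulate : ∀ m {f} (g : Fin m → ℕ) → (∀ i → f (toℕ i) ≡ g i) → ∑ m f ≡ sum (tabulate g)
∑-tabulate zero    g h = refl
∑-tabulate (suc m) g h = cong₂ _+_ (h Fin.zero) (∑-tabulate m (g ∘ Fin.suc) (h ∘ Fin.suc))

from-Fin : ∀ {m} (P : ℕ → Set) → (∀ (i : Fin m) → P (toℕ i)) → ∀ {v} → v < m → P v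
from-Fin P h v<m = subst P (toℕ-fromℕ< v<m) (h (fromℕ< v<m))

-- Choosing an occurrence of each element in the concatenation of the sets is injective, because a
-- position determines its element.
elements≤size : ∀ S → Collection.numElements S ≤ problemSize S
elements≤size S = subst (numElements ≤_) (length-concat-tabulate numSets member)
  (injective⇒≤ {f = λ a → Any.index (occurs a)} λ {a} {b} → index-injective (setoid _) (occurs a) (occurs b))
  where
  open Collection S
  occurs : ∀ a → a ∈ concat (tabulate member)
  occurs a = let i , a∈ = covers a in ∈-concat⁺′ a∈ (∈-tabulate⁺ i)

length>0 : ∀ {A : Set} {xs : List A} → xs ≢ [] → 1 ≤ length xs
length>0 {xs = []}     xs≢[] = contradiction refl xs≢[]
length>0 {xs = x ∷ xs} _     = s≤s z≤n

-- The search starts with j = 0 and chooses at once, so `set(0)`, which holds all the edges, must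
-- not be empty.
elements>0 : ∀ S → 0 < Collection.numElements S
elements>0 S = ≤-trans (s≤s z≤n) (toℕ<n (lookup (member i) (fromℕ< (length>0 (nonempty i)))))
  where
  open Collection S
  i = fromℕ< numSets>0

record SetCells (m n : ℕ) (slen : ℕ → ℕ) (#m #n : ℤ) (SL ST : Cells) : Set where
  field
    #m≡       : #m ≡ + m
    #n≡       : #n ≡ + n
    setLen≡   : ∀ {v} → v < m → SL at v ≡ + slen v
    sets∈     : ∀ {v q} → v < m → q < slen v → ∃[ G ] (G < n × ST (+ v) (+ q) ≡ + G)
    distinct  : ∀ {v p q} → v < m → p < slen v → q < slen v → ST (+ v) (+ p) ≡ ST (+ v) (+ q) → p ≡ q

-- Lengths are read back from memory by `trunc`, which makes them functions on all of ℕ, as the sums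
-- require, rather than on `Fin`.
encoded : ∀ {σ S} → σ Encodes S → let open Collection S ; SL = tab σ setLen in
  SetCells numSets numElements (λ v → trunc (SL at v)) (var σ #m) (var σ #n) SL (tab σ sets) ×
  (∑[ v < numSets ] trunc (SL at v)) ≡ problemSize S × numSets ≤ problemSize S
encoded {σ} {S} enc = record
    { #m≡      = var-m
    ; #n≡      = var-n
    ; setLen≡  = from-Fin (λ v → SL at v ≡ + trunc (SL at v)) λ i →
        trans (tab-setLen i) (cong (λ z → + trunc z) (sym (tab-setLen i)))
    ; sets∈    = λ v<m q<s → from-Fin (λ v → ∀ {q} → q < trunc (SL at v) → ∃[ G ] (G < numElements × ST (+ v) (+ q) ≡ + G))
        (λ i q<s → let r = fromℕ< (in-row i q<s) in
          toℕ (lookup (member i) r) , toℕ<n (lookup (member i) r) , entry i q<s) v<m q<s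
    ; distinct = λ v<m p<s q<s eq → from-Fin (λ v → ∀ {p q} → p < trunc (SL at v) → q < trunc (SL at v) →
          ST (+ v) (+ p) ≡ ST (+ v) (+ q) → p ≡ q)
        (λ i {p} {q} p<s q<s eq → trans (sym (toℕ-fromℕ< (in-row i p<s))) (trans
          (cong toℕ (lookup-injective (Collection.distinct S i) _ _ (toℕ-injective (ℤ.+-injective
            (trans (sym (entry i p<s)) (trans eq (entry i q<s)))))))
          (toℕ-fromℕ< (in-row i q<s)))) v<m p<s q<s eq
    } , total , sets≤
  where
  open Collection S using (numSets; numElements; member; nonempty)
  open _Encodes_ enc
  SL = tab σ setLen
  ST = tab σ sets
  in-row : ∀ i {q} → q < trunc (SL at toℕ i) → q < length (member i)
  in-row i q<s = subst (_ <_) (cong trunc (tab-setLen i)) q<s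
  entry : ∀ i {q} (q<s : q < trunc (SL at toℕ i)) → ST (+ toℕ i) (+ q) ≡ + toℕ (lookup (member i) (fromℕ< (in-row i q<s)))
  entry i q<s = trans (cong (λ q → ST (+ toℕ i) (+ q)) (sym (toℕ-fromℕ< (in-row i q<s)))) (tab-sets i _)
  total : (∑[ v < numSets ] trunc (SL at v)) ≡ problemSize S
  total = ∑-tabulate numSets (λ i → length (member i)) λ i → cong trunc (tab-setLen i)
  sets≤ : numSets ≤ problemSize S
  sets≤ = subst₂ _≤_ (trans (∑-const numSets 1) (*-identityʳ numSets)) total
    (∑-mono numSets λ v → from-Fin (λ v → 1 ≤ trunc (SL at v)) λ i →
      subst (1 ≤_) (sym (cong trunc (tab-setLen i))) (length>0 (nonempty i)))

module Dual (m n : ℕ) (slen : ℕ → ℕ) where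

  SetInput : Store → Set
  SetInput σ = SetCells m n slen (var σ #m) (var σ #n) (tab σ setLen) (tab σ sets)

  -- `bound` follows the number of sets entered and ends as m, which yields `elen≤m`. `total` counts
  -- the entries copied and yields Σ|E| ≤ Σ|Sᵢ|.
  record DualCells (bound total : ℕ) (EL ET : Cells) : Set where
    field
      natural : ∀ {G} → G < n → EL at G ≡ + trunc (EL at G)
      bounded : ∀ {G} → G < n → trunc (EL at G) ≤ bound
      entries : ∀ {G p} → G < n → p < trunc (EL at G) → ∃[ v ] (v < m × ET (+ G) (+ p) ≡ + v)
      total≤  : (∑[ G < n ] trunc (EL at G)) ≤ total
  open DualCells

  DualState : ℕ → ℕ → Store → Set
  DualState b t σ = DualCells b t (tab σ edgeLen) (tab σ edges)

  append : ∀ {b t EL ET v G a z} → DualCells b t EL ET → G < n → v < m → trunc (EL at G) < b →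
    a ≡ + G → z ≡ + v → DualCells b (suc t) (EL [ a ∣ 0ℤ ↦ EL a 0ℤ +ℤ 1ℤ ]) (ET [ a ∣ EL a 0ℤ ↦ z ])
  append {b} {t} {EL} {ET} {v} {G} dual G<n v<m G<b refl refl = record
    { natural = natural′ ; bounded = bounded′ ; entries = entries′ ; total≤ = total′ }
    where
    c = trunc (EL at G)
    EL′ = EL [ + G ∣ 0ℤ ↦ EL at G +ℤ 1ℤ ]
    ET′ = ET [ + G ∣ EL at G ↦ + v ]
    EL′G : EL′ at G ≡ + suc c
    EL′G = trans (at-hit EL G _) (trans (cong (_+ℤ 1ℤ) (natural dual G<n)) (cong +_ (+-comm c 1)))
    other : ∀ {H} → G ≢ H → EL′ at H ≡ EL at H
    other G≢H = at-row EL G _ G≢H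
    natural′ : ∀ {H} → H < n → EL′ at H ≡ + trunc (EL′ at H)
    natural′ {H} H<n with G ≡? H
    ... | yes refl = trans EL′G (cong (λ z → + trunc z) (sym EL′G))
    ... | no G≢H   = trans (other G≢H) (trans (natural dual H<n) (cong (λ z → + trunc z) (sym (other G≢H))))
    bounded′ : ∀ {H} → H < n → trunc (EL′ at H) ≤ b
    bounded′ {H} H<n with G ≡? H
    ... | yes refl = subst (_≤ b) (sym (cong trunc EL′G)) G<b
    ... | no G≢H   = subst (_≤ b) (sym (cong trunc (other G≢H))) (bounded dual H<n)
    entries′ : ∀ {H p} → H < n → p < trunc (EL′ at H) → ∃[ v ] (v < m × ET′ (+ H) (+ p) ≡ + v)
    entries′ {H} {p} H<n p<l with G ≡? H
    ... | no G≢H with w , w<m , eq ← entries dual H<n (subst (p <_) (cong trunc (other G≢H)) p<l) =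
      w , w<m , trans (write-row ET _ _ _ (+≢ G≢H)) eq
    ... | yes refl with c ≡? p
    ...   | yes refl = v , v<m , trans (cong (ET′ (+ G)) (sym (natural dual G<n))) (write-hit ET (+ G) (EL at G) (+ v))
    ...   | no c≢p with w , w<m , eq ← entries dual H<n (≤∧≢⇒< (≤-pred (subst (p <_) (cong trunc EL′G) p<l)) (c≢p ∘ sym)) =
      w , w<m , trans (write-column ET (+ G) (EL at G) (+ v) (+ G) (λ eq → c≢p (cong trunc eq))) eq
    total′ : (∑[ H < n ] trunc (EL′ at H)) ≤ suc t
    total′ = +-cancelʳ-≤ c _ _ (begin
      (∑[ H < n ] trunc (EL′ at H)) + c
        ≡⟨ ∑-update n G<n (λ H _ H≢G → cong trunc (other (H≢G ∘ sym))) ⟩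
      (∑[ H < n ] trunc (EL at H)) + trunc (EL′ at G)
        ≤⟨ +-mono-≤ (total≤ dual) (≤-reflexive (cong trunc EL′G)) ⟩
      t + suc c
        ≡⟨ +-suc t c ⟩
      suc t + c ∎)
      where open ≤-Reasoning

  weaken-bound : ∀ {b t EL ET} → DualCells b t EL ET → DualCells (suc b) t EL ET
  weaken-bound dual = record
    { natural = natural dual
    ; bounded = λ G<n → m≤n⇒m≤1+n (bounded dual G<n)
    ; entries = entries dual
    ; total≤  = total≤ dual
    }

  listSet : Com
  listSet = for Var.q from lit 0ℤ below setLen ⟦ ! Var.v ⟧ do[
    (Var.a ≔ sets ⟦ ! Var.v ∣ ! Var.q ⟧) ︔
    (edges ⟦ ! Var.a ∣ edgeLen ⟦ ! Var.a ⟧ ⟧← ! Var.v) ︔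
    (edgeLen ⟦ ! Var.a ⟧← edgeLen ⟦ ! Var.a ⟧ ⊕ lit 1ℤ) ]

  run-listSet : ∀ {v t σ φ} → v < m → var σ Var.v ≡ + v → SetInput σ → DualState v t σ →
    Run listSet σ (2 + (slen v * 3 + φ)) (λ σ′ φ′ → SetInput σ′ × DualState (suc v) (t + slen v) σ′ × φ ≤ φ′)
  run-listSet {v} {t} {σ} {ψ} v<m v≡ input dual = consequence
    (λ (input , dual , _ , _ , credit) → input , dual , credit)
    (uniformLoop 0 (slen v) 1 I refl refl (λ _ → refl) listed
      (trans (cong (λ z → trunc (tab σ setLen z 0ℤ)) v≡) (cong trunc (SetCells.setLen≡ input v<m)))
      (input , subst (λ t → DualState (suc v) t σ) (sym (+-identityʳ t)) (weaken-bound dual) , fresh₀ , v≡ , ≤-refl))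
    where
    -- A set lists each of its elements once, so the edges still to come do not contain v yet.
    Fresh : ℕ → Store → Set
    Fresh q σ = ∀ {p G} → q ≤ p → p < slen v → G < n → tab σ sets (+ v) (+ p) ≡ + G → trunc (tab σ edgeLen at G) ≤ v
    I : ℕ → Assertion
    I q σ φ = SetInput σ × DualState (suc v) (t + q) σ × Fresh q σ × var σ Var.v ≡ + v × ψ ≤ φ
    fresh₀ : Fresh 0 σ
    fresh₀ _ _ G<n _ = bounded dual G<n
    listed : ∀ q {σ φ} → q < slen v → var σ Var.q ≡ + q → I q σ φ →
      Run ((Var.a ≔ sets ⟦ ! Var.v ∣ ! Var.q ⟧) ︔
           (edges ⟦ ! Var.a ∣ edgeLen ⟦ ! Var.a ⟧ ⟧← ! Var.v) ︔
           (edgeLen ⟦ ! Var.a ⟧← edgeLen ⟦ ! Var.a ⟧ ⊕ lit 1ℤ)) σ (1 + φ)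
        (λ σ′ φ′ → I (suc q) (setVar Var.q (+ suc q) σ′) φ′)
    listed q {σ} q<s q≡ (input , dual , fresh , v≡ , credit) with G , G<n , ST ← SetCells.sets∈ input v<m q<s =
      straight (input ,
        subst (λ t → DualCells (suc v) t EL′ (tab σ edges [ a ∣ EL a 0ℤ ↦ var σ Var.v ])) (sym (+-suc t q))
          (append dual G<n v<m (s≤s (fresh ≤-refl q<s G<n ST)) a≡ v≡) ,
        fresh′ , v≡ , credit)
      where
      a = tab σ sets (var σ Var.v) (var σ Var.q)
      EL = tab σ edgeLen
      EL′ = EL [ a ∣ 0ℤ ↦ EL a 0ℤ +ℤ 1ℤ ]
      a≡ : a ≡ + G
      a≡ = trans (cong₂ (tab σ sets) v≡ q≡) ST
      fresh′ : ∀ {p H} → suc q ≤ p → p < slen v → H < n → tab σ sets (+ v) (+ p) ≡ + H → trunc (EL′ at H) ≤ v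
      fresh′ q<p p<s H<n eq = subst (_≤ v)
        (cong trunc (sym (write-row EL 0ℤ _ 0ℤ λ a≡H → <⇒≢ q<p
          (SetCells.distinct input v<m q<s p<s (trans ST (trans (sym a≡) (trans a≡H (sym eq))))))))
        (fresh (<⇒≤ q<p) p<s H<n eq)

  run-constructDual : ∀ {σ} ψ → SetInput σ →
    Run constructDual σ (2 + (n * 3 + (2 + ((∑[ v < m ] 4 + slen v * 3) + ψ))))
      (λ σ′ φ′ → SetInput σ′ × DualState m (∑ m slen) σ′ × ψ ≤ φ′)
  run-constructDual ψ input = seq (consequence
    (λ { {σ} (input , zeros , credit) → weaken credit (forLoop 0 m (λ v → 2 + slen v * 3) I refl refl (λ _ → refl)
      (λ { v {σ} v<m v≡ (input , dual , credit) → consequence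
        (λ { {σ} (input , dual , credit′) → input , subst (λ t → DualState (suc v) t σ) (sym (∑-suc v slen)) dual ,
                                     ≤-trans credit credit′ })
        (run-listSet v<m v≡ input dual) })
      (cong trunc (SetCells.#m≡ input)) (input , empty {σ} zeros , ≤-refl)) })
    (uniformLoop 0 n 1 Zeros refl refl (λ _ → refl)
      (λ { q {σ} q<n a≡ (input , zeros , credit) → straight (input , fill (tab σ edgeLen) a≡ zeros , credit) })
      (cong trunc (SetCells.#n≡ input)) (input , (λ ()) , ≤-refl)))
    where
    Zeros I : ℕ → Assertion
    Zeros q σ φ = SetInput σ × (∀ {G} → G < q → tab σ edgeLen at G ≡ 0ℤ) ×
      2 + ((∑[ v < m ] 4 + slen v * 3) + ψ) ≤ φ
    I v σ φ = SetInput σ × DualState v (∑ v slen) σ × ψ ≤ φ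
    empty : ∀ {σ} → (∀ {G} → G < n → tab σ edgeLen at G ≡ 0ℤ) → DualState 0 0 σ
    empty zeros = record
      { natural = λ G<n → trans (zeros G<n) (cong (λ z → + trunc z) (sym (zeros G<n)))
      ; bounded = λ G<n → ≤-reflexive (cong trunc (zeros G<n))
      ; entries = λ G<n p<l → contradiction (subst (_ <_) (cong trunc (zeros G<n)) p<l) λ ()
      ; total≤  = ≤-reflexive (trans (∑-cong n λ G G<n → cong trunc (zeros G<n)) (trans (∑-const n 0) (*-zeroʳ n)))
      }

  dual⇒input : ∀ {b t #m #n SL ST EL ET} → b ≤ m → SetCells m n slen #m #n SL ST → DualCells b t EL ET →
    Acyclicity.InputCells m n slen (λ G → trunc (EL at G)) #m #n SL ST EL ET
  dual⇒input b≤m input dual = record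
    { #m≡      = SetCells.#m≡ input
    ; #n≡      = SetCells.#n≡ input
    ; setLen≡  = SetCells.setLen≡ input
    ; sets∈    = SetCells.sets∈ input
    ; edgeLen≡ = natural dual
    ; edges∈   = entries dual
    ; elen≤m   = λ G<n → ≤-trans (bounded dual G<n) b≤m
    }

-- Collecting the credits

∑-suc-weights : ∀ n f → (∑[ i < n ] suc (f i)) ≡ n + ∑ n f
∑-suc-weights n f = trans (∑-distrib-+ n (λ _ → 1) f) (cong (_+ ∑ n f) (trans (∑-const n 1) (*-identityʳ n)))

-- `acyclicCredit` with Σ(1 + |E|) replaced by its bound n + P and Σ(1 + |S_v|) by m + P, together
-- with the call, the final branch and `genForest`.
afterDualCredit : (m n P : ℕ) → ℕ
afterDualCredit m n P = 28 + 25 * m + 44 * n + 47 * P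

-- The postcondition `⊥` applies to the outcome `finished` alone, so it says that the program ends
-- by a `return`.
run-afterDual : ∀ {m n slen elen P σ φ} → Acyclicity.Input m n slen elen σ → 0 < m → 0 < n →
  ∑ m slen ≡ P → ∑ n elen ≤ P → afterDualCredit m n P ≤ φ →
  Run ((Var.ok ≔call isAcyclic) ︔
       cond (! Var.ok =̇ lit 1ℤ) (genForest ︔ return (lit 1ℤ)) (return (lit 0ℤ))) σ φ (λ _ _ → ⊥)
run-afterDual {m} {n} {slen} {elen} {P} {σ} input 0<m 0<n refl elen≤P credit =
  weaken (≤-trans acyclic≤ credit)
    (seq (call (Acyclicity.run-isAcyclic m n slen elen 0<m 0<n input) (λ e → decide (outcome-#n e))))
  where
  W = ∑[ G < n ] suc (elen G)
  T′ = ∑[ v < m ] suc (slen v)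
  acyclic≤ : 1 + (22 + 9 * m + 7 * n + 31 * W + 16 * T′ + (1 + (3 + (n * 6 + 1)))) ≤ afterDualCredit m n P
  acyclic≤ = begin
    1 + (22 + 9 * m + 7 * n + 31 * W + 16 * T′ + (1 + (3 + (n * 6 + 1))))
      ≡⟨ linear₁ m n W T′ ⟩
    28 + 9 * m + 13 * n + 31 * W + 16 * T′
      ≤⟨ +-mono-≤ (+-monoʳ-≤ (28 + 9 * m + 13 * n)
           (*-monoʳ-≤ 31 (≤-trans (≤-reflexive (∑-suc-weights n elen)) (+-monoʳ-≤ n elen≤P))))
           (*-monoʳ-≤ 16 (≤-reflexive (∑-suc-weights m slen))) ⟩
    28 + 9 * m + 13 * n + 31 * (n + P) + 16 * (m + P)
      ≡⟨ linear₂ m n P ⟩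
    afterDualCredit m n P ∎
    where
    open ≤-Reasoning
    linear₁ : ∀ m n W T → 1 + (22 + 9 * m + 7 * n + 31 * W + 16 * T + (1 + (3 + (n * 6 + 1)))) ≡
      28 + 9 * m + 13 * n + 31 * W + 16 * T
    linear₁ = solve-∀
    linear₂ : ∀ m n P → 28 + 9 * m + 13 * n + 31 * (n + P) + 16 * (m + P) ≡ 28 + 25 * m + 44 * n + 47 * P
    linear₂ = solve-∀
  -- `genForest` loops up to `#n`, whose value survives every outcome of the call because
  -- `isAcyclic` never assigns it.
  outcome-#n : ∀ {o σ′ t} → ⟨ isAcyclic , σ ⟩⇓⟨ o , σ′ ⟩in t → var (assignResult Var.ok o σ′) #n ≡ + n
  outcome-#n {finished}   e = trans (assigns-sound #n e refl) (Acyclicity.InputCells.#n≡ input)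
  outcome-#n {returned _} e = trans (assigns-sound #n e refl) (Acyclicity.InputCells.#n≡ input)
  decide : ∀ {σ} → var σ #n ≡ + n → Run _ σ (1 + (3 + (n * 6 + 1))) (λ _ _ → ⊥)
  decide n≡ = branch
    (λ _ → seq (consequence (λ 1≤φ → weaken 1≤φ leave) (Acyclicity.run-genForest m n slen elen 1 n≡)))
    (λ _ → weaken (s≤s z≤n) leave)

-- The additive constant 32 is absorbed through `1 ≤ P`; 158 is 32 + 29 + 47 + 50.
totalCredit-linear : ∀ m n P → m ≤ P → n ≤ P → 1 ≤ P →
  2 + (n * 3 + (2 + (m * 4 + P * 3 + afterDualCredit m n P))) ≤ 158 * P
totalCredit-linear m n P m≤P n≤P 1≤P = begin
  2 + (n * 3 + (2 + (m * 4 + P * 3 + afterDualCredit m n P)))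
    ≡⟨ linear m n P ⟩
  32 * 1 + 29 * m + 47 * n + 50 * P
    ≤⟨ +-monoˡ-≤ (50 * P) (+-mono-≤ (+-mono-≤ (*-monoʳ-≤ 32 1≤P) (*-monoʳ-≤ 29 m≤P)) (*-monoʳ-≤ 47 n≤P)) ⟩
  32 * P + 29 * P + 47 * P + 50 * P
    ≡⟨ collect P ⟩
  158 * P ∎
  where
  open ≤-Reasoning
  linear : ∀ m n P → 2 + (n * 3 + (2 + (m * 4 + P * 3 + (28 + 25 * m + 44 * n + 47 * P)))) ≡
    32 * 1 + 29 * m + 47 * n + 50 * P
  linear = solve-∀
  collect : ∀ P → 32 * P + 29 * P + 47 * P + 50 * P ≡ 158 * P
  collect = solve-∀

theorem5 : ∃[ c ] ((S : Collection) (σ : Store) → σ Encodes S →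
    ∃[ n ] ∃[ z ] ∃[ σ′ ]
    ((⟨ isTreeConvex , σ ⟩⇓⟨ returned z , σ′ ⟩in n) × (n ≤ c * problemSize S)))
-- 158 credits per unit of problem size, each worth `unit` steps. Because `σ` is arbitrary outside
-- the input, the oracle and hence all choices of the search are covered.
theorem5 = unit * 158 , linear-run
  where
  linear-run : (S : Collection) (σ : Store) → σ Encodes S →
    ∃[ n ] ∃[ z ] ∃[ σ′ ] ((⟨ isTreeConvex , σ ⟩⇓⟨ returned z , σ′ ⟩in n) × (n ≤ unit * 158 * problemSize S))
  linear-run S σ enc with input , total , m≤P ← encoded {σ} {S} enc = conclude whole
    where
    open Collection S using (numSets; numElements; numSets>0)
    P = problemSize S
    slen : ℕ → ℕ
    slen v = trunc (tab σ setLen at v)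
    open Dual numSets numElements slen
    open DualCells using (total≤)
    dualCredit : (∑[ v < numSets ] 4 + slen v * 3) ≡ numSets * 4 + P * 3
    dualCredit = trans (∑-distrib-+ numSets (λ _ → 4) (λ v → slen v * 3)) (cong₂ _+_ (∑-const numSets 4)
      (trans (∑-cong numSets λ v _ → *-comm (slen v) 3) (trans (∑-distrib-* numSets 3 slen)
        (trans (*-comm 3 (∑ numSets slen)) (cong (_* 3) total)))))
    whole : Run isTreeConvex σ (158 * P) (λ _ _ → ⊥)
    whole = weaken
      (subst (λ s → 2 + (numElements * 3 + (2 + (s + afterDualCredit numSets numElements P))) ≤ 158 * P) (sym dualCredit)
        (totalCredit-linear numSets numElements P m≤P (elements≤size S) (≤-trans numSets>0 m≤P)))
      (seq (consequence
        (λ (input , dual , credit) → run-afterDual (dual⇒input ≤-refl input dual) numSets>0 (elements>0 S)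
          total (≤-trans (total≤ dual) (≤-reflexive total)) credit)
        (run-constructDual (afterDualCredit numSets numElements P) input)))
    conclude : Run isTreeConvex σ (158 * P) (λ _ _ → ⊥) →
      ∃[ n ] ∃[ z ] ∃[ σ′ ] ((⟨ isTreeConvex , σ ⟩⇓⟨ returned z , σ′ ⟩in n) × (n ≤ unit * 158 * P))
    conclude (run {returned z} {σ′} {n} e h _) =
      n , z , σ′ , e , ≤-trans (≤-trans (m≤m+n n _) h) (≤-reflexive (sym (*-assoc unit 158 P)))
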